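{- Let $r,h$ be nonnegative integers with $h\ge 4$, and let $G$ be a graph excluding $K_h$ as a minor. Then for every integer $k$ with $1\le k\le |V(G)|$, \[ \mathrm{pc}_r(G,k)\le 4^h(h-3)\,h^{2(h-1)}\,(r+1)^{3(h-1)}\,k . \] In particular $\mathrm{pc}_r(G,k)\in h^{O(h)}(r+1)^{3(h-1)}k$, where the constant in the exponent $O(h)$ is absolute.
   Context: All graphs are finite, simple, loopless and undirected. $\mathrm{dist}(u,v)$ is the usual graph distance (number of edges of a shortest path, $+\infty$ if there is none). For an integer $r$, let $\mathrm{Cap}_r(\ell)=\ell$ if $\ell\le r$ and $\mathrm{Cap}_r(\ell)=+\infty$ otherwise. For $A\subseteq V(G)$ and $v\in V(G)$, the $r$-profile of $v$ with respect to $A$ is the function $p_r(v,A):A\to\mathbb N\cup\{+\infty\}$, $a\mapsto \mathrm{Cap}_r(\mathrm{dist}(a,v))$. Let $\mathrm{pc}_r(G,A)=\big|\{p_r(v,A): v\in V(G)\}\setminus\{a\mapsto+\infty\}\big|$ (the number of distinct $r$-profiles with respect to $A$, not counting the constant $+\infty$ profile), and let $\mathrm{pc}_r(G,k)=\max\{\mathrm{pc}_r(G,A): A\subseteq V(G), |A|=k\}$ (the $r$-profile complexity of $G$). -}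

module Defs where

open import Data.Bool.Base using (if_then_else_)
open import Data.Fin.Base using (Fin)
open import Data.Fin.Properties using (_≟_; any?; all?)
open import Data.Fin.Subset using (Subset; inside; outside; _∈_; _∩_; Nonempty; Empty; ∣_∣)
open import Data.Fin.Subset.Properties using (_∈?_)
open import Data.List.Base as List using (List; []; _∷_; _++_; allFin; deduplicate; filter; length; upTo)
open import Data.List.Extrema.Nat using (max)
open import Data.Nat.Base using (ℕ; zero; suc; _≤ᵇ_)
import Data.Nat.Properties as ℕ
open import Data.Product.Base using (∃; ∃-syntax; ∃₂; _×_; _,_)
open import Data.Vec.Base as Vec using (Vec; []; _∷_; head; last)
open import Data.Vec.Properties.WithK using ([]=-irrelevant)
open import Data.Vec.Relation.Unary.AllPairs using (allPairs?)
open import Data.Vec.Relation.Unary.Linked using (Linked; linked?)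
open import Data.Vec.Relation.Unary.Unique.Propositional using (Unique)
open import Level using (0ℓ)
open import Relation.Binary.Construct.Closure.ReflexiveTransitive using (Star)
open import Relation.Binary.Core using (Rel)
open import Relation.Binary.Definitions using (Symmetric; Irreflexive; Decidable)
open import Relation.Binary.PropositionalEquality using (_≡_; _≢_; cong; trans; ≢-sym)
open import Relation.Nullary using (Dec; yes; no; ¬?; contradiction; map′; _×-dec_)
open import Relation.Nullary.Construct.Add.Supremum using (_⁺; ⊤⁺; [_])
open import Relation.Nullary.Construct.Add.Point using (≡-dec)

record Graph (n : ℕ) : Set₁ where
  field
    Adj    : Rel (Fin n) 0ℓ
    symm   : Symmetric Adj
    irrefl : Irreflexive _≡_ Adj
    adj?   : Decidable Adj

Complete : ∀ h → Graph h
Complete h = record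
  { Adj    = _≢_
  ; symm   = ≢-sym
  ; irrefl = λ i≡j i≢j → i≢j i≡j
  ; adj?   = λ i j → ¬? (i ≟ j)
  }

-- S induces a connected subgraph; this allows S to be empty.
Connected : ∀ {n} → Graph n → Subset n → Set
Connected G S = ∀ {u v} → u ∈ S → v ∈ S →
                Star (λ x y → x ∈ S × y ∈ S × Graph.Adj G x y) u v

-- H is a minor of G, via a family of branch sets.
record _MinorOf_ {m n} (H : Graph m) (G : Graph n) : Set where
  field
    branch    : Fin m → Subset n
    nonempty  : ∀ i → Nonempty (branch i)
    connected : ∀ i → Connected G (branch i)
    disjoint  : ∀ {i j} → i ≢ j → Empty (branch i ∩ branch j)
    edges     : ∀ {i j} → Graph.Adj H i j →
                ∃₂ λ u v → u ∈ branch i × v ∈ branch j × Graph.Adj G u v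

private
  anyVec? : ∀ {n} k {P : Vec (Fin n) k → Set} → (∀ xs → Dec (P xs)) → Dec (∃ P)
  anyVec? zero    P? = map′ (λ p → [] , p) (λ { ([] , p) → p }) (P? [])
  anyVec? (suc k) P? = map′ (λ { (x , xs , p) → x ∷ xs , p }) (λ { (x ∷ xs , p) → x , xs , p })
                            (any? λ x → anyVec? k λ xs → P? (x ∷ xs))

module _ {n} (G : Graph n) where
  open Graph G

  -- Paths with ℓ edges, as sequences of ℓ + 1 distinct vertices.
  Path : Fin n → Fin n → ℕ → Set
  Path u v ℓ = ∃[ xs ] head {n = ℓ} xs ≡ u × last xs ≡ v × Linked Adj xs × Unique xs

  path? : ∀ u v ℓ → Dec (Path u v ℓ)
  path? u v ℓ = anyVec? (suc ℓ) λ xs →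
    head xs ≟ u ×-dec last xs ≟ v ×-dec linked? adj? xs ×-dec allPairs? (λ x y → ¬? (x ≟ y)) xs

  -- The least length of a path from u to v, and ⊤⁺ (that is, +∞) if there is none;
  -- lengths below n suffice since the vertices of a path are distinct.
  -- As ℕ ⁺ is Maybe ℕ, List.head of an empty list is ⊤⁺.
  dist : Fin n → Fin n → ℕ ⁺
  dist u v = List.head (filter (path? u v) (upTo n))

Cap : ℕ → ℕ ⁺ → ℕ ⁺
Cap r [ ℓ ] = if ℓ ≤ᵇ r then [ ℓ ] else ⊤⁺
Cap r ⊤⁺    = ⊤⁺

-- Functions A → ℕ ∪ {+∞}, compared pointwise.
Profile : ∀ {n} → Subset n → Set
Profile A = ∀ a → a ∈ A → ℕ ⁺

_≈ₚ_ : ∀ {n} {A : Subset n} → Profile A → Profile A → Set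
p ≈ₚ q = ∀ a a∈A → p a a∈A ≡ q a a∈A

_≈ₚ?_ : ∀ {n} {A : Subset n} → Decidable (_≈ₚ_ {n} {A})
_≈ₚ?_ {A = A} p q = all? eq?
  where
  eq? : ∀ a → Dec (∀ a∈A → p a a∈A ≡ q a a∈A)
  eq? a with a ∈? A
  ... | no  a∉A = yes λ a∈A → contradiction a∈A a∉A
  ... | yes a∈A = map′ (λ eq a∈A′ → trans (cong (p a) ([]=-irrelevant a∈A′ a∈A))
                                     (trans eq (cong (q a) ([]=-irrelevant a∈A a∈A′))))
                       (λ eq → eq a∈A)
                       (≡-dec ℕ._≟_ (p a a∈A) (q a a∈A))

const∞ : ∀ {n} {A : Subset n} → Profile A
const∞ _ _ = ⊤⁺

subsets : ∀ n → List (Subset n)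
subsets zero    = [] ∷ []
subsets (suc n) = List.map (outside ∷_) (subsets n) ++ List.map (inside ∷_) (subsets n)

module _ {n} (G : Graph n) (r : ℕ) where

  profile : Fin n → (A : Subset n) → Profile A
  profile v A a _ = Cap r (dist G a v)

  pcOf : Subset n → ℕ
  pcOf A = length (filter (λ p → ¬? (p ≈ₚ? const∞))
                          (deduplicate _≈ₚ?_ (List.map (λ v → profile v A) (allFin n))))

  -- For k ≤ n there are subsets of size k, so the default value 0 only serves k > n.
  pc : ℕ → ℕ
  pc k = max 0 (List.map pcOf (filter (λ A → ∣ A ∣ ℕ.≟ k) (subsets n)))

module Submission where

-- Let π number the parts of a layering of G: each part is split off from a component C of
-- the remaining graph {π ≥ i} and is a union of at most h − 3 shortest paths of C through
-- neighbours of all earlier parts next to C. Those earlier parts are connected and pairwise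
-- adjacent, so they and C form a complete minor, and there are at most h − 2 of them.
-- Hence from any vertex a at most (r + 1)^(h − 2) parts i can be reached by walks of length
-- at most r within {π ≥ i}, and only few vertices in each, since shortest paths meet balls in
-- few vertices.
--
-- For a vertex v with a finite profile, let y be a vertex with π y maximal that is reached
-- from v and from some a ∈ A in this sense. Every short path from v to A meets one of
-- O(h² r) gates that depend on y only, so y and the profile of v on the gates determine the
-- profile of v on A. The balls of a K_h-minor-free graph have VC dimension less than h
-- (Voronoi cells turn a shattered set of size h into a minor), so the Sauer–Shelah lemma
-- bounds the number of profiles on the gates.

open import Defs
open import Data.Bool.Base using (Bool; true; false; T)
import Data.Bool.Properties as Bool
open import Data.Fin.Base using (Fin; zero; suc; toℕ; inject≤)
open import Data.Fin.Properties using (_≟_; any?; all?; toℕ-injective; inject≤-injective)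
import Data.Fin.Properties as Fin
open import Data.Fin.Subset using (Subset; _∈_; _⊂_; ∣_∣; inside; outside)
open import Data.Fin.Subset.Induction using (⊂-wellFounded)
open import Data.Fin.Subset.Properties using (_∈?_; x∈p∩q⁻)
open import Data.List.Base as List
  using (List; []; _∷_; _++_; allFin; applyUpTo; cartesianProduct; concatMap; filter; length; map; upTo)
import Data.List.Extrema.Nat as Extrema
open import Data.List.Membership.Propositional as List using (find)
import Data.List.Membership.Propositional.Properties as List
import Data.List.Properties as List
open import Data.List.Relation.Unary.All as All using (All; []; _∷_)
import Data.List.Relation.Unary.All.Properties as All
open import Data.List.Relation.Unary.AllPairs as AllPairs using (AllPairs; []; _∷_)
import Data.List.Relation.Unary.AllPairs.Properties as AllPairs
open import Data.List.Relation.Unary.Any as Any using (Any; here; there)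
open import Data.List.Relation.Unary.Unique.DecSetoid.Properties using (deduplicate-!)
open import Data.List.Relation.Unary.Unique.Propositional using (Unique)
import Data.List.Relation.Unary.Unique.Propositional.Properties as Unique
open import Data.Maybe.Base using (Maybe; just; nothing; fromMaybe)
open import Data.Nat.Base using (ℕ; zero; suc; _+_; _*_; _∸_; _^_; _≤_; _<_; _≥_; _≤ᵇ_; z≤n; s≤s; s≤s⁻¹)
import Data.Nat.Properties as ℕ
open import Data.Nat.Solver using (module +-*-Solver)
open import Data.Product.Base using (∃; ∃-syntax; ∃₂; _×_; _,_; proj₁; proj₂)
open import Data.Sum.Base using (_⊎_; inj₁; inj₂; [_,_])
open import Data.Vec.Base as Vec using (Vec; []; _∷_; lookup; tabulate)
import Data.Vec.Properties as Vec
open import Data.Vec.Relation.Unary.All as VecAll using ([]; _∷_)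
import Data.Vec.Relation.Unary.All.Properties as VecAll
open import Data.Vec.Relation.Unary.AllPairs using ([]; _∷_)
import Data.Vec.Relation.Unary.Any as VecAny
open import Data.Vec.Relation.Unary.Linked using ([-]; _∷_)
import Data.Vec.Relation.Unary.Unique.Propositional.Properties as VecUnique
open import Induction.WellFounded using (Acc; acc)
open import Level using (0ℓ)
open import Relation.Binary.Bundles using (DecSetoid)
open import Relation.Binary.Construct.Closure.ReflexiveTransitive as Star using (Star; ε; _◅_; _◅◅_)
open import Relation.Binary.Core using (Rel)
open import Relation.Binary.Definitions using (DecidableEquality; tri<; tri≈; tri>)
open import Relation.Binary.PropositionalEquality hiding ([_]; J)
open import Relation.Nullary using (Dec; yes; no; ¬_; ¬?; contradiction; map′; _×-dec_; _⊎-dec_; does)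
open import Relation.Nullary.Construct.Add.Supremum using (_⁺)
open import Relation.Nullary.Decidable using (dec-true)
open import Relation.Unary using (Pred; Decidable)

open Graph

-- Walks and distances

private variable
  n d e : ℕ
  u v w : Fin n

_⊑_ : Graph n → Graph n → Set
G ⊑ H = ∀ {u v} → Adj G u v → Adj H u v

-- Walks with at most d edges.
data Walk (G : Graph n) : ℕ → Fin n → Fin n → Set where
  stay : Walk G d u u
  step : Adj G u w → Walk G d w v → Walk G (suc d) u v

module _ {G : Graph n} where

  walk-≤ : d ≤ e → Walk G d u v → Walk G e u v
  walk-≤ d≤e       stay       = stay
  walk-≤ (s≤s d≤e) (step a p) = step a (walk-≤ d≤e p)

  walk-trans : Walk G d u v → Walk G e v w → Walk G (d + e) u w
  walk-trans {d = d} {e = e} stay q = walk-≤ (ℕ.m≤n+m e d) q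
  walk-trans (step a p) q = step a (walk-trans p q)

  walk-snoc : Walk G d u v → Adj G v w → Walk G (suc d) u w
  walk-snoc stay       b = step b stay
  walk-snoc (step a p) b = step a (walk-snoc p b)

  walk-sym : Walk G d u v → Walk G d v u
  walk-sym stay       = stay
  walk-sym (step a p) = walk-snoc (walk-sym p) (symm G a)

walk-⊑ : {G H : Graph n} → G ⊑ H → Walk G d u v → Walk H d u v
walk-⊑ G⊑H stay       = stay
walk-⊑ G⊑H (step a p) = step (G⊑H a) (walk-⊑ G⊑H p)

walk? : (G : Graph n) → ∀ d u v → Dec (Walk G d u v)
walk? G zero u v = map′ (λ { refl → stay }) (λ { stay → refl }) (u ≟ v)
walk? G (suc d) u v =
  map′ (λ { (inj₁ refl) → stay ; (inj₂ (_ , a , p)) → step a p })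
       (λ { stay → inj₁ refl ; (step a p) → inj₂ (_ , a , p) })
       (u ≟ v ⊎-dec any? λ w → adj? G u w ×-dec walk? G d w v)

module _ (G : Graph n) where

  path⇒walk : ∀ {u v} ℓ → Path G u v ℓ → Walk G ℓ u v
  path⇒walk zero    (_ ∷ [] , refl , refl , _ , _) = stay
  path⇒walk (suc ℓ) (_ ∷ xs , refl , refl , a ∷ lk , _ ∷ uq) =
    step a (path⇒walk ℓ (xs , refl , refl , lk , uq))

  path-length : ∀ {u v ℓ} → Path G u v ℓ → ℓ < n
  path-length (xs , _ , _ , _ , uq) =
    Fin.injective⇒≤ {f = Vec.lookup xs} λ {i} {j} → VecUnique.lookup-injective uq i j

  path-suffix : ∀ {u v w} ℓ (p : Path G u v ℓ) → VecAny.Any (w ≡_) (proj₁ p) →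
                ∃[ k ] k ≤ ℓ × Path G w v k
  path-suffix ℓ (_ ∷ _ , refl , lst , lk , uq) (VecAny.here refl) =
    ℓ , ℕ.≤-refl , _ , refl , lst , lk , uq
  path-suffix (suc ℓ) (_ ∷ xs , _ , lst , _ ∷ lk , _ ∷ uq) (VecAny.there w∈)
    with k , k≤ , p ← path-suffix ℓ (xs , refl , lst , lk , uq) w∈ = k , ℕ.m≤n⇒m≤1+n k≤ , p

  walk⇒path : ∀ {u v d} → Walk G d u v → ∃[ ℓ ] ℓ ≤ d × Path G u v ℓ
  walk⇒path {u} stay = 0 , z≤n , u ∷ [] , refl , refl , [-] , VecAll.[] ∷ []
  walk⇒path {u} (step a p) with ℓ , ℓ≤ , q@(xs , refl , lst , lk , uq) ← walk⇒path p
    with VecAny.any? (u ≟_) xs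
  ... | yes u∈ with k , k≤ , q′ ← path-suffix ℓ q u∈ = k , ℕ.m≤n⇒m≤1+n (ℕ.≤-trans k≤ ℓ≤) , q′
  ... | no  u∉ = suc ℓ , s≤s ℓ≤ , u ∷ xs , refl , lst , a ∷ lk , ¬any⇒all u∉ ∷ uq
    where
    ¬any⇒all : ∀ {k} {ys : Vec (Fin n) k} → ¬ VecAny.Any (u ≡_) ys → VecAll.All (u ≢_) ys
    ¬any⇒all {ys = []}     _  = VecAll.[]
    ¬any⇒all {ys = y ∷ ys} ¬a = (λ eq → ¬a (VecAny.here eq)) VecAll.∷ ¬any⇒all (λ z → ¬a (VecAny.there z))

  -- A path has fewer than `n` edges. Hence `Walk G n` serves below as a decidable form of
  -- connectivity.
  walk-shorten : ∀ {u v d} → Walk G d u v → Walk G n u v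
  walk-shorten p with ℓ , _ , q ← walk⇒path p = walk-≤ (ℕ.<⇒≤ (path-length q)) (path⇒walk ℓ q)

module _ {P : ℕ → Set} (P? : ∀ i → Dec (P i)) where

  -- With the identity for `f` this unfolds to the expression that defines `dist`; a general `f` is
  -- what the recursion of `first-view` shifts.
  first : (ℕ → ℕ) → ℕ → Maybe ℕ
  first f N = List.head (filter P? (applyUpTo f N))

  data First (f : ℕ → ℕ) (N : ℕ) : Set where
    none  : first f N ≡ nothing → (∀ {i} → i < N → ¬ P (f i)) → First f N
    found : ∀ i → first f N ≡ just (f i) → i < N → P (f i) → (∀ {j} → P (f j) → i ≤ j) → First f N

  first-view : ∀ f N → First f N
  first-view f zero = none refl λ ()
  first-view f (suc N) with P? (f 0) in eq
  ... | yes p = found 0 lem (s≤s z≤n) p λ _ → z≤n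
    where
    lem : first f (suc N) ≡ just (f 0)
    lem rewrite eq = refl
  ... | no ¬p with first-view (λ i → f (suc i)) N
  ...   | none is none′ = none (trans lem is) λ { {zero} _ → ¬p ; {suc i} i< → none′ (s≤s⁻¹ i<) }
    where
    lem : first f (suc N) ≡ first (λ i → f (suc i)) N
    lem rewrite eq = refl
  ...   | found i is i< q min = found (suc i) (trans lem is) (s≤s i<) q
            λ { {zero} q′ → contradiction q′ ¬p ; {suc j} q′ → s≤s (min q′) }
    where
    lem : first f (suc N) ≡ first (λ i → f (suc i)) N
    lem rewrite eq = refl

-- Distances truncated at N, which also is the value for vertices that are not connected.
module Truncated (G : Graph n) (N : ℕ) where

  abstract
    tdist : Fin n → Fin n → ℕ
    tdist u v = fromMaybe N (first (λ d → walk? G d u v) (λ d → d) N)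

    tdist≤ : ∀ {u v} d → Walk G d u v → tdist u v ≤ d
    tdist≤ {u} {v} d p with first-view (λ d → walk? G d u v) (λ d → d) N
    ... | none  eq none′       rewrite eq = ℕ.≮⇒≥ λ d<N → none′ d<N p
    ... | found i eq _ _ min   rewrite eq = min p

    tdist≤N : ∀ u v → tdist u v ≤ N
    tdist≤N u v with first-view (λ d → walk? G d u v) (λ d → d) N
    ... | none  eq _         rewrite eq = ℕ.≤-refl
    ... | found i eq i<N _ _ rewrite eq = ℕ.<⇒≤ i<N

    tdist-walk : ∀ u v → Walk G (tdist u v) u v ⊎ tdist u v ≡ N
    tdist-walk u v with first-view (λ d → walk? G d u v) (λ d → d) N
    ... | none  eq _       rewrite eq = inj₂ refl
    ... | found i eq _ p _ rewrite eq = inj₁ p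

  tdist-walk< : ∀ {u v d} → tdist u v ≤ d → d < N → Walk G d u v
  tdist-walk< {u} {v} t≤d d<N with tdist-walk u v
  ... | inj₁ p  = walk-≤ t≤d p
  ... | inj₂ eq = contradiction (ℕ.≤-trans (ℕ.≤-reflexive (sym eq)) t≤d) (ℕ.<⇒≱ d<N)

  tdist-lipschitz : ∀ u {v w} → Adj G v w → tdist u w ≤ suc (tdist u v)
  tdist-lipschitz u {v} {w} a with tdist-walk u v
  ... | inj₁ p  = tdist≤ _ (walk-snoc p a)
  ... | inj₂ eq = ℕ.≤-trans (tdist≤N u w) (ℕ.≤-trans (ℕ.≤-reflexive (sym eq)) (ℕ.n≤1+n _))

-- The vertices v with π v < i are kept, but become isolated.
above : Graph n → (Fin n → ℕ) → ℕ → Graph n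
above G π i = record
  { Adj    = λ u v → i ≤ π u × i ≤ π v × Adj G u v
  ; symm   = λ (pu , pv , a) → pv , pu , symm G a
  ; irrefl = λ eq (_ , _ , a) → irrefl G eq a
  ; adj?   = λ u v → i ℕ.≤? π u ×-dec i ℕ.≤? π v ×-dec adj? G u v
  }

-- Describes the entries of a profile by walks alone, so that profiles can be compared without
-- unfolding `dist`.
data Capped (G : Graph n) (r : ℕ) (u v : Fin n) : ℕ ⁺ → Set where
  beyond  : ¬ Walk G r u v → Capped G r u v nothing
  attained : ∀ {ℓ} → ℓ ≤ r → Walk G ℓ u v → (∀ {d} → Walk G d u v → ℓ ≤ d) → Capped G r u v (just ℓ)

capped : ∀ (G : Graph n) r u v → Capped G r u v (Cap r (dist G u v))
capped {n} G r u v with first-view (path? G u v) (λ d → d) n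
... | none eq none′ rewrite eq = beyond λ p → let ℓ , _ , q = walk⇒path G p in none′ (path-length G q) q
... | found ℓ eq _ p min rewrite eq with ℓ ≤ᵇ r in ℓ≤ᵇr
...   | true  = attained (ℕ.≤ᵇ⇒≤ ℓ r (subst T (sym ℓ≤ᵇr) _)) (path⇒walk G ℓ p)
                     λ q → let k , k≤ , q′ = walk⇒path G q in ℕ.≤-trans (min q′) k≤
...   | false = beyond λ q → let k , k≤ , q′ = walk⇒path G q in
                     subst T ℓ≤ᵇr (ℕ.≤⇒≤ᵇ (ℕ.≤-trans (min q′) k≤))

-- Counting and shattering in lists

length-split : ∀ {A : Set} {P : Pred A 0ℓ} (P? : Decidable P) xs →
               length xs ≡ length (filter P? xs) + length (filter (λ x → ¬? (P? x)) xs)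
length-split P? []       = refl
length-split P? (x ∷ xs) with P? x
... | yes _ = cong suc (length-split P? xs)
... | no  _ = trans (cong suc (length-split P? xs)) (sym (ℕ.+-suc _ _))

all-pairs : ∀ {A : Set} {P : Pred A 0ℓ} {R : Rel A 0ℓ} {xs} → All P xs → AllPairs R xs →
            AllPairs (λ x y → P x × P y × R x y) xs
all-pairs []       []       = []
all-pairs (p ∷ ps) (r ∷ rs) = All.zipWith (λ (q , s) → p , q , s) (ps , r) ∷ all-pairs ps rs

module _ {A B : Set} (_≟_ : DecidableEquality B) {R : Rel A 0ℓ} {S : Pred A 0ℓ} (f : A → B) (M : ℕ)
         (fibre : ∀ {ys y} → AllPairs R ys → All S ys → All (λ x → f x ≡ y) ys → length ys ≤ M) where

  -- Counts by the fibres of `f` over `keys`. The relation `R` is `_≢_` when vertices are counted,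
  -- and difference of profiles in the final count; `S` carries what the bound for a fibre needs.
  fibre-bound : ∀ keys {xs} → AllPairs R xs → All S xs → All (λ x → f x List.∈ keys) xs →
                length xs ≤ length keys * M
  fibre-bound []       {[]}     _  _  _        = z≤n
  fibre-bound []       {_ ∷ _}  _  _  (() ∷ _)
  fibre-bound (k ∷ ks) {xs}     rs ss f∈ = begin
    length xs                                ≡⟨ length-split k? xs ⟩
    length (filter k? xs) + length (filter (λ x → ¬? (k? x)) xs)
      ≤⟨ ℕ.+-mono-≤ (fibre (AllPairs.filter⁺ k? rs) (All.filter⁺ k? ss) (All.all-filter k? xs))
                    (fibre-bound ks (AllPairs.filter⁺ _ rs) (All.filter⁺ _ ss)
                      (All.zipWith other (All.all-filter (λ x → ¬? (k? x)) xs , All.filter⁺ _ f∈))) ⟩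
    M + length ks * M                        ∎
    where
    open ℕ.≤-Reasoning
    k? : Decidable (λ x → f x ≡ k)
    k? x = f x ≟ k
    other : ∀ {x} → f x ≢ k × f x List.∈ k ∷ ks → f x List.∈ ks
    other (≢k , here ≡k)  = contradiction ≡k ≢k
    other (_  , there f∈) = f∈

all⇒map : ∀ {A E : Set} (f : E → A) {xs} → All (λ x → ∃ λ e → f e ≡ x) xs → ∃ λ es → List.map f es ≡ xs
all⇒map f []               = [] , refl
all⇒map f ((e , refl) ∷ p) with es , refl ← all⇒map f p = e ∷ es , refl

-- As `L` has no repetitions, `x` itself occurs at most once, which the `suc` pays for.
length-split-at : ∀ x {L} → Unique L →
                  length L ≤ length (filter (ℕ._<? x) L) + suc (length (filter (x ℕ.<?_) L))
length-split-at x {[]}    _ = z≤n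
length-split-at x {y ∷ L} (y∉ ∷ L!) with ℕ.<-cmp y x
... | tri< y<x _ x≮y rewrite List.filter-accept (ℕ._<? x) {xs = L} y<x | List.filter-reject (x ℕ.<?_) {xs = L} x≮y =
  s≤s (length-split-at x L!)
... | tri> y≮x _ x<y rewrite List.filter-reject (ℕ._<? x) {xs = L} y≮x | List.filter-accept (x ℕ.<?_) {xs = L} x<y =
  ℕ.≤-trans (s≤s (length-split-at x L!)) (ℕ.≤-reflexive (sym (ℕ.+-suc _ _)))
... | tri≈ y≮x refl x≮y rewrite List.filter-reject (ℕ._<? x) {xs = L} y≮x | List.filter-reject (x ℕ.<?_) {xs = L} x≮y =
  ℕ.≤-trans (s≤s (without y∉)) (ℕ.≤-reflexive (sym (ℕ.+-suc _ _)))
  where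
  without : ∀ {L} → All (x ≢_) L → length L ≤ length (filter (ℕ._<? x) L) + length (filter (x ℕ.<?_) L)
  without [] = z≤n
  without {y ∷ L} (x≢y ∷ x∉) with ℕ.<-cmp y x
  ... | tri< y<x _ x≮y rewrite List.filter-accept (ℕ._<? x) {xs = L} y<x | List.filter-reject (x ℕ.<?_) {xs = L} x≮y =
    s≤s (without x∉)
  ... | tri> y≮x _ x<y rewrite List.filter-reject (ℕ._<? x) {xs = L} y≮x | List.filter-accept (x ℕ.<?_) {xs = L} x<y =
    ℕ.≤-trans (s≤s (without x∉)) (ℕ.≤-reflexive (sym (ℕ.+-suc _ _)))
  ... | tri≈ _ y≡x _ = contradiction (sym y≡x) x≢y

-- The maximal size of a set system on m points that shatters no k of them.
Φ : ℕ → ℕ → ℕ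
Φ zero    m       = 0
Φ (suc k) zero    = 1
Φ (suc k) (suc m) = Φ (suc k) m + Φ k m

-- By Pascal's rule, `Φ (suc k) m` is the number of subsets of size at most `k` of an `m`-element
-- set.
Φ-≤ : ∀ k m → Φ (suc k) m ≤ suc m ^ k
Φ-≤ k       zero    = ℕ.≤-reflexive (sym (ℕ.^-zeroˡ k))
Φ-≤ zero    (suc m) = ℕ.≤-trans (ℕ.≤-reflexive (ℕ.+-identityʳ _)) (Φ-≤ zero m)
Φ-≤ (suc k) (suc m) = begin
  Φ (2 + k) m + Φ (1 + k) m     ≤⟨ ℕ.+-mono-≤ (Φ-≤ (suc k) m) (Φ-≤ k m) ⟩
  suc m ^ suc k + suc m ^ k     ≡⟨ ℕ.+-comm (suc m ^ suc k) _ ⟩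
  (2 + m) * suc m ^ k           ≤⟨ ℕ.*-monoʳ-≤ (2 + m) (ℕ.^-monoˡ-≤ k (ℕ.n≤1+n (suc m))) ⟩
  (2 + m) ^ suc k               ∎
  where open ℕ.≤-Reasoning

module Sauer {V P : Set} (R : V → P → Bool) where

  trace : List P → V → List Bool
  trace ps v = List.map (R v) ps

  Shatters : ∀ {k} → List V → Vec P k → Set
  Shatters {k} vs Q = ∀ (b : Vec Bool k) → ∃[ v ] v List.∈ vs × Vec.map (R v) Q ≡ b

  trace-∈ : ∀ {ps u v q} → trace ps u ≡ trace ps v → q List.∈ ps → R u q ≡ R v q
  trace-∈ eq (here refl) = List.∷-injectiveˡ eq
  trace-∈ eq (there q∈)  = trace-∈ (List.∷-injectiveʳ eq) q∈

  trace-Vec : ∀ {k ps u v} {Q : Vec P k} → trace ps u ≡ trace ps v → VecAll.All (List._∈ ps) Q →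
              Vec.map (R u) Q ≡ Vec.map (R v) Q
  trace-Vec eq []        = refl
  trace-Vec eq (q∈ ∷ Q⊆) = cong₂ _∷_ (trace-∈ eq q∈) (trace-Vec eq Q⊆)

  -- Removing the point `p` merges traces in pairs. `N ++ V₀` keeps one element for each trace on
  -- `ps`, and `I` collects the elements whose trace on `ps` occurs both with and without `p`.
  -- Whatever `I` shatters, `vs` shatters together with `p`, so `I` falls under the bound for `k`.
  sauer-shelah : ∀ k ps {vs} → AllPairs (λ u v → trace ps u ≢ trace ps v) vs →
                 (∀ (Q : Vec P k) → VecAll.All (List._∈ ps) Q → ¬ Shatters vs Q) →
                 length vs ≤ Φ k (length ps)
  sauer-shelah zero ps {[]}    _ _   = z≤n
  sauer-shelah zero ps {v ∷ _} _ ¬sh = contradiction (λ { [] → v , here refl , refl }) (¬sh [] [])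
  sauer-shelah (suc k) [] {[]}        _ _ = z≤n
  sauer-shelah (suc k) [] {_ ∷ []}    _ _ = s≤s z≤n
  sauer-shelah (suc k) [] {_ ∷ _ ∷ _} ((≢[] ∷ _) ∷ _) _ = contradiction refl ≢[]
  sauer-shelah (suc k) (p ∷ ps) {vs} sep ¬sh = begin
    length vs                             ≡⟨ length-split in? vs ⟩
    length V₁ + length V₀                 ≡⟨ cong (_+ length V₀) (length-split twin? V₁) ⟩
    (length I + length N) + length V₀     ≡⟨ ℕ.+-assoc (length I) _ _ ⟩
    length I + (length N + length V₀)     ≡⟨ ℕ.+-comm (length I) _ ⟩
    (length N + length V₀) + length I     ≡⟨ cong (_+ length I) (List.length-++ N) ⟨
    length (N ++ V₀) + length I           ≤⟨ ℕ.+-mono-≤ (sauer-shelah (suc k) ps sepU ¬shU)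
                                                        (sauer-shelah k ps sepI ¬shI) ⟩
    Φ (suc k) (length ps) + Φ k (length ps) ∎
    where
    open ℕ.≤-Reasoning
    in? : Decidable (λ v → R v p ≡ true)
    in? v = R v p Bool.≟ true
    V₁ V₀ : List V
    V₁ = filter in? vs
    V₀ = filter (λ v → ¬? (in? v)) vs
    twin? : Decidable (λ v → Any (λ w → trace ps v ≡ trace ps w) V₀)
    twin? v = Any.any? (λ w → List.≡-dec Bool._≟_ (trace ps v) (trace ps w)) V₀
    I N : List V
    I = filter twin? V₁
    N = filter (λ v → ¬? (twin? v)) V₁

    ∈V₁ : ∀ {v} → v List.∈ V₁ → v List.∈ vs × R v p ≡ true
    ∈V₁ = List.∈-filter⁻ in?
    ∈V₀ : ∀ {v} → v List.∈ V₀ → v List.∈ vs × R v p ≡ false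
    ∈V₀ v∈ with v∈vs , ≢t ← List.∈-filter⁻ (λ v → ¬? (in? v)) {xs = vs} v∈ = v∈vs , Bool.¬-not ≢t

    restrict : ∀ {b ws} → All (λ v → R v p ≡ b) ws → AllPairs (λ u v → trace (p ∷ ps) u ≢ trace (p ∷ ps) v) ws →
               AllPairs (λ u v → trace ps u ≢ trace ps v) ws
    restrict eqs nes = AllPairs.map (λ (eq , eq′ , ne) tr → ne (cong₂ _∷_ (trans eq (sym eq′)) tr)) (all-pairs eqs nes)

    sep₁ : AllPairs (λ u v → trace ps u ≢ trace ps v) V₁
    sep₁ = restrict (All.tabulate λ v∈ → proj₂ (∈V₁ v∈)) (AllPairs.filter⁺ in? sep)
    sep₀ : AllPairs (λ u v → trace ps u ≢ trace ps v) V₀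
    sep₀ = restrict (All.tabulate λ v∈ → proj₂ (∈V₀ v∈)) (AllPairs.filter⁺ (λ v → ¬? (in? v)) sep)
    sepI : AllPairs (λ u v → trace ps u ≢ trace ps v) I
    sepI = AllPairs.filter⁺ twin? sep₁
    sepU : AllPairs (λ u v → trace ps u ≢ trace ps v) (N ++ V₀)
    sepU = AllPairs.++⁺ (AllPairs.filter⁺ (λ v → ¬? (twin? v)) sep₁) sep₀
             (All.map (λ {v} → All.¬Any⇒All¬ V₀) (All.all-filter (λ v → ¬? (twin? v)) V₁))

    ¬shU : ∀ (Q : Vec P (suc k)) → VecAll.All (List._∈ ps) Q → ¬ Shatters (N ++ V₀) Q
    ¬shU Q Q⊆ sh = ¬sh Q (VecAll.map there Q⊆) λ b → let v , v∈ , eq = sh b in v , ∈U v∈ , eq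
      where
      ∈U : ∀ {v} → v List.∈ N ++ V₀ → v List.∈ vs
      ∈U v∈ with List.∈-++⁻ N v∈
      ... | inj₁ v∈N = proj₁ (∈V₁ (proj₁ (List.∈-filter⁻ (λ v → ¬? (twin? v)) v∈N)))
      ... | inj₂ v∈V₀ = proj₁ (∈V₀ v∈V₀)

    ¬shI : ∀ (Q : Vec P k) → VecAll.All (List._∈ ps) Q → ¬ Shatters I Q
    ¬shI Q Q⊆ sh = ¬sh (p ∷ Q) (here refl ∷ VecAll.map there Q⊆) shattered
      where
      shattered : Shatters vs (p ∷ Q)
      shattered (b ∷ bs) with v , v∈I , eq ← sh bs with v∈V₁ , tw ← List.∈-filter⁻ twin? {xs = V₁} v∈I
        with b
      ... | true  = v , proj₁ (∈V₁ v∈V₁) , cong₂ _∷_ (proj₂ (∈V₁ v∈V₁)) eq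
      -- The twin of `v` has the same trace on `ps` but misses `p`.
      ... | false with w , w∈V₀ , tr ← find tw =
        w , proj₁ (∈V₀ w∈V₀) , cong₂ _∷_ (proj₂ (∈V₀ w∈V₀)) (trans (sym (trace-Vec tr Q⊆)) eq)

-- Balls have bounded VC dimension

module _ {P : Fin n → Set} (P? : ∀ v → Dec (P v)) where

  satisfying : Subset n
  satisfying = tabulate λ v → does (P? v)

  ∈-satisfying⁺ : ∀ {v} → P v → v ∈ satisfying
  ∈-satisfying⁺ {v} p = Vec.lookup⇒[]= v _ (trans (Vec.lookup∘tabulate _ v) (dec-true (P? v) p))

  ∈-satisfying⁻ : ∀ {v} → v ∈ satisfying → P v
  ∈-satisfying⁻ {v} v∈ with P? v | trans (sym (Vec.lookup∘tabulate (λ v → does (P? v)) v)) (Vec.[]=⇒lookup v∈)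
  ... | yes p | _ = p

Inside : Graph n → (Fin n → Set) → Fin n → Fin n → Set
Inside G P x y = P x × P y × Adj G x y

-- Both minors of the proof, from Voronoi cells and from the layering, are built in this form, where
-- connectivity is checked from a root only.
complete-minor : ∀ {n h} (G : Graph n) (B : Fin h → Fin n → Set) → (∀ i v → Dec (B i v)) →
                 (root : Fin h → Fin n) → (∀ i → B i (root i)) →
                 (∀ i {v} → B i v → Star (Inside G (B i)) (root i) v) →
                 (∀ {i j v} → B i v → B j v → i ≡ j) →
                 (∀ {i j} → i ≢ j → ∃₂ λ u v → B i u × B j v × Adj G u v) →
                 Complete h MinorOf G
complete-minor G B B? root root∈ conn disj edge = record
  { branch    = λ i → satisfying (B? i)
  ; nonempty  = λ i → root i , ∈-satisfying⁺ (B? i) (root∈ i)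
  ; connected = λ i u∈ v∈ → Star.map (lift i)
      (Star.reverse (λ (px , py , a) → py , px , symm G a) (conn i (∈-satisfying⁻ (B? i) u∈))
        ◅◅ conn i (∈-satisfying⁻ (B? i) v∈))
  ; disjoint  = λ {i} {j} i≢j (v , v∈) →
      let v∈i , v∈j = x∈p∩q⁻ (satisfying (B? i)) (satisfying (B? j)) v∈ in
      i≢j (disj (∈-satisfying⁻ (B? i) v∈i) (∈-satisfying⁻ (B? j) v∈j))
  ; edges     = λ {i} {j} i≢j → let u , v , pu , pv , a = edge i≢j in
      u , v , ∈-satisfying⁺ (B? i) pu , ∈-satisfying⁺ (B? j) pv , a
  }
  where
  lift : ∀ i {x y} → Inside G (B i) x y → x ∈ satisfying (B? i) × y ∈ satisfying (B? i) × Adj G x y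
  lift i (px , py , a) = ∈-satisfying⁺ (B? i) px , ∈-satisfying⁺ (B? i) py , a

does-⇒ : {A B : Set} (a? : Dec A) (b? : Dec B) → does a? ≡ does b? → A → B
does-⇒ (yes _) (yes b) _ _ = b
does-⇒ (no ¬a) _       _ a = contradiction a ¬a

-- The branch sets are the cells of the Voronoi diagram of the centres x i
-- for the additively weighted distances of cost.
module Voronoi {n h} (G : Graph n) (r : ℕ) (x : Fin h → Fin n) (l : Fin h → ℕ) (l≤r : ∀ i → l i ≤ r)
  (select : (b : Fin h → Bool) → ∃[ v ] ∀ i → does (walk? G (l i) (x i) v) ≡ b i) where

  -- Truncated values exceed `r`, so vertices that are too far from a centre lie outside its cell.
  open Truncated G (suc r)

  -- The shift by `r ∸ l i` gives all balls the common radius `r`: `cost i u ≤ r` holds exactly when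
  -- `u` is within distance `l i` of `x i`.
  cost : Fin h → Fin n → ℕ
  cost i u = tdist (x i) u + (r ∸ l i)

  walk⇒cost : ∀ {i u d} → Walk G d u (x i) → cost i u ≤ d + (r ∸ l i)
  walk⇒cost {i} p = ℕ.+-monoˡ-≤ (r ∸ l i) (tdist≤ _ (walk-sym p))

  cost⇒walk : ∀ {i u} → cost i u ≤ r → Walk G (l i) (x i) u
  cost⇒walk {i} {u} c≤r = tdist-walk< (begin
    tdist (x i) u      ≤⟨ ℕ.m+n≤o⇒m≤o∸n _ c≤r ⟩
    r ∸ (r ∸ l i)      ≡⟨ ℕ.m∸[m∸n]≡n (l≤r i) ⟩
    l i                ∎) (s≤s (l≤r i))
    where open ℕ.≤-Reasoning

  cost-lipschitz : ∀ i {u w} → Adj G w u → cost i u ≤ suc (cost i w)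
  cost-lipschitz i a = ℕ.+-monoˡ-≤ (r ∸ l i) (tdist-lipschitz (x i) a)

  Beats : Fin n → Fin h → Fin h → Set
  Beats u i j = cost i u < cost j u ⊎ (cost i u ≡ cost j u × toℕ i ≤ toℕ j)

  Cell : Fin h → Fin n → Set
  Cell i u = cost i u ≤ r × ∀ j → Beats u i j

  cell? : ∀ i u → Dec (Cell i u)
  cell? i u = cost i u ℕ.≤? r ×-dec
    all? λ j → cost i u ℕ.<? cost j u ⊎-dec (cost i u ℕ.≟ cost j u ×-dec toℕ i ℕ.≤? toℕ j)

  beats-total : ∀ u i j → Beats u i j ⊎ Beats u j i
  beats-total u i j with ℕ.<-cmp (cost i u) (cost j u) | ℕ.≤-total (toℕ i) (toℕ j)
  ... | tri< lt _ _ | _        = inj₁ (inj₁ lt)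
  ... | tri> _ _ gt | _        = inj₂ (inj₁ gt)
  ... | tri≈ _ eq _ | inj₁ i≤j = inj₁ (inj₂ (eq , i≤j))
  ... | tri≈ _ eq _ | inj₂ j≤i = inj₂ (inj₂ (sym eq , j≤i))

  beats-antisym : ∀ {u i j} → Beats u i j → Beats u j i → i ≡ j
  beats-antisym (inj₁ lt)         (inj₁ gt)        = contradiction gt (ℕ.<-asym lt)
  beats-antisym (inj₁ lt)         (inj₂ (eq , _))  = contradiction (sym eq) (ℕ.<⇒≢ lt)
  beats-antisym (inj₂ (eq , _))   (inj₁ gt)        = contradiction (sym eq) (ℕ.<⇒≢ gt)
  beats-antisym (inj₂ (_ , i≤j))  (inj₂ (_ , j≤i)) = toℕ-injective (ℕ.≤-antisym i≤j j≤i)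

  beats⇒≤ : ∀ {u i j} → Beats u i j → cost i u ≤ cost j u
  beats⇒≤ (inj₁ lt)       = ℕ.<⇒≤ lt
  beats⇒≤ (inj₂ (eq , _)) = ℕ.≤-reflexive eq

  cell-unique : ∀ {i j u} → Cell i u → Cell j u → i ≡ j
  cell-unique {i} {j} (_ , b) (_ , b′) = beats-antisym (b j) (b′ i)

  -- A shortest walk from a vertex of a cell to the centre stays in the cell.
  cell-star : ∀ {i u d} → Cell i u → Walk G d u (x i) → d ≤ tdist (x i) u →
              Cell i (x i) × Star (Inside G (Cell i)) u (x i)
  cell-star         c stay _ = c , ε
  cell-star {i} {u} c@(c≤r , b) (step {w = w} a p) d≤ =
    let cw = ℕ.≤-trans (ℕ.n≤1+n _) (ℕ.≤-trans closer c≤r) , λ j → beats j (b j)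
        cx , st = cell-star cw p (s≤s⁻¹ (ℕ.≤-trans d≤ (tdist-lipschitz (x i) (symm G a))))
    in cx , (c , cw , a) ◅ st
    where
    closer : suc (cost i w) ≤ cost i u
    closer = ℕ.+-monoˡ-≤ (r ∸ l i) (ℕ.≤-trans (s≤s (tdist≤ _ (walk-sym p))) d≤)
    beats : ∀ j → Beats u i j → Beats w i j
    beats j (inj₁ lt) = inj₁ (s≤s⁻¹ (ℕ.≤-trans (s≤s closer) (ℕ.≤-trans lt (cost-lipschitz j (symm G a)))))
    beats j (inj₂ (eq , i≤j))
      with ℕ.m≤n⇒m<n∨m≡n (s≤s⁻¹ (ℕ.≤-trans closer (ℕ.≤-trans (ℕ.≤-reflexive eq) (cost-lipschitz j (symm G a)))))
    ... | inj₁ lt  = inj₁ lt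
    ... | inj₂ eq′ = inj₂ (eq′ , i≤j)

  cell⇒star : ∀ {i u} → Cell i u → Cell i (x i) × Star (Inside G (Cell i)) u (x i)
  cell⇒star {i} {u} c@(c≤r , _) with tdist-walk (x i) u
  ... | inj₁ p  = cell-star c (walk-sym p) ℕ.≤-refl
  ... | inj₂ eq = contradiction (ℕ.≤-trans (ℕ.≤-trans (ℕ.≤-reflexive (sym eq)) (ℕ.m≤m+n _ _)) c≤r) ℕ.1+n≰n

  OthersFar : Fin h → Fin h → Fin n → ℕ → Set
  OthersFar i j u D = ∀ m → m ≢ i → m ≢ j → D < cost m u

  -- The better of `i` and `j` costs at most `D`, and all other centres cost more.
  winner : ∀ {i j u D} → cost i u ≤ D ⊎ cost j u ≤ D → D ≤ r → OthersFar i j u D → Cell i u ⊎ Cell j u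
  winner {i} {j} {u} {D} c≤D D≤r far with beats-total u i j
  ... | inj₁ i▸j = inj₁ (ℕ.≤-trans ci≤D D≤r , beats)
    where
    ci≤D : cost i u ≤ D
    ci≤D = [ (λ z → z) , ℕ.≤-trans (beats⇒≤ i▸j) ] c≤D
    beats : ∀ m → Beats u i m
    beats m with m ≟ i | m ≟ j
    ... | yes refl | _        = inj₂ (refl , ℕ.≤-refl)
    ... | no _     | yes refl = i▸j
    ... | no m≢i   | no m≢j   = inj₁ (ℕ.≤-<-trans ci≤D (far m m≢i m≢j))
  ... | inj₂ j▸i = inj₂ (ℕ.≤-trans cj≤D D≤r , beats)
    where
    cj≤D : cost j u ≤ D
    cj≤D = [ ℕ.≤-trans (beats⇒≤ j▸i) , (λ z → z) ] c≤D
    beats : ∀ m → Beats u j m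
    beats m with m ≟ i | m ≟ j
    ... | _        | yes refl = inj₂ (refl , ℕ.≤-refl)
    ... | yes refl | no _     = j▸i
    ... | no m≢i   | no m≢j   = inj₁ (ℕ.≤-<-trans cj≤D (far m m≢i m≢j))

  -- On a short walk to x j, all vertices are in cell i or cell j, and the last one is in cell j.
  crossing : ∀ {i j u d} → i ≢ j → Cell j (x j) → Cell i u → Walk G d u (x j) →
             d + (r ∸ l j) ≤ r → OthersFar i j u (d + (r ∸ l j)) →
             ∃₂ λ u v → Cell i u × Cell j v × Adj G u v
  crossing         i≢j cj ci stay       _   _   = contradiction (cell-unique ci cj) i≢j
  crossing {i} {j} i≢j cj ci (step {w = w} a p) d≤r far = next (winner (inj₂ (walk⇒cost p)) d≤r′ far′)
    where
    d≤r′ = ℕ.≤-trans (ℕ.n≤1+n _) d≤r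
    -- One step lowers the cost of any other centre by at most one, and the threshold drops by one
    -- as well.
    far′ : OthersFar i j w _
    far′ m m≢i m≢j = s≤s⁻¹ (ℕ.≤-trans (far m m≢i m≢j) (cost-lipschitz m (symm G a)))
    next : Cell i w ⊎ Cell j w → _
    next (inj₁ ciw) = crossing i≢j cj ciw p d≤r′ far′
    next (inj₂ cjw) = _ , w , ci , cjw , a

  -- The only place where shattering enters: it is used for two balls, or for a single one when
  -- `i ≡ j`.
  pair : ∀ i j → ∃[ v ] Walk G (l i) v (x i) × Walk G (l j) v (x j) × OthersFar i j v r
  pair i j with v , eq ← select (λ m → does (m ≟ i ⊎-dec m ≟ j)) =
    v , near i (inj₁ refl) , near j (inj₂ refl) , far
    where
    near : ∀ m → m ≡ i ⊎ m ≡ j → Walk G (l m) v (x m)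
    near m m∈ = walk-sym (does-⇒ (m ≟ i ⊎-dec m ≟ j) (walk? G _ _ _) (sym (eq m)) m∈)
    far : OthersFar i j v r
    far m m≢i m≢j = ℕ.≰⇒> λ c≤r →
      [ m≢i , m≢j ] (does-⇒ (walk? G _ _ _) (m ≟ i ⊎-dec m ≟ j) (eq m) (cost⇒walk c≤r))

  l+[r∸l] : ∀ i → l i + (r ∸ l i) ≡ r
  l+[r∸l] i = ℕ.m+[n∸m]≡n (l≤r i)

  near⇒cost : ∀ {i u} → Walk G (l i) u (x i) → cost i u ≤ r
  near⇒cost {i} p = ℕ.≤-trans (walk⇒cost p) (ℕ.≤-reflexive (l+[r∸l] i))

  centre : ∀ i → Cell i (x i)
  centre i with v , p , _ , far ← pair i i
    with winner (inj₁ (near⇒cost p)) ℕ.≤-refl far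
  ... | inj₁ c = proj₁ (cell⇒star c)
  ... | inj₂ c = proj₁ (cell⇒star c)

  -- A vertex in the balls of `i` and `j` only lies in one of the two cells, and a short walk from
  -- it to the other centre has to cross between them.
  cells-adjacent : ∀ {i j} → i ≢ j → ∃₂ λ u v → Cell i u × Cell j v × Adj G u v
  cells-adjacent {i} {j} i≢j with v , p , q , far ← pair i j
    with winner (inj₁ (near⇒cost p)) ℕ.≤-refl far
  ... | inj₁ c = crossing i≢j (centre j) c q (ℕ.≤-reflexive (l+[r∸l] j))
                   (subst (OthersFar i j v) (sym (l+[r∸l] j)) far)
  ... | inj₂ c = let u , w , cu , cw , a = crossing (≢-sym i≢j) (centre i) c p (ℕ.≤-reflexive (l+[r∸l] i))
                                             (subst (OthersFar j i v) (sym (l+[r∸l] i)) λ m m≢j m≢i → far m m≢i m≢j)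
                 in w , u , cw , cu , symm G a

  minor : Complete h MinorOf G
  minor = complete-minor G Cell cell? x centre
    (λ i c → Star.reverse (λ (px , py , a) → py , px , symm G a) (proj₂ (cell⇒star c)))
    cell-unique cells-adjacent

-- Layerings by shortest paths

at : ∀ {n} {G : Graph n} {d u v} → Walk G d u v → ℕ → Fin n
at {u = u} stay       k       = u
at {u = u} (step _ p) zero    = u
at         (step _ p) (suc k) = at p k

module _ {n} {G : Graph n} where

  at-first : ∀ {d u v} (p : Walk G d u v) → at p 0 ≡ u
  at-first stay       = refl
  at-first (step _ _) = refl

  at-last : ∀ {d u v} (p : Walk G d u v) → at p d ≡ v
  at-last stay       = refl
  at-last (step _ p) = at-last p

  at-next : ∀ {d u v} (p : Walk G d u v) k → at p k ≡ at p (suc k) ⊎ Adj G (at p k) (at p (suc k))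
  at-next stay       k       = inj₁ refl
  at-next (step a p) zero    = inj₂ (subst (Adj G _) (sym (at-first p)) a)
  at-next (step a p) (suc k) = at-next p k

  at-walk : ∀ {d u v} (p : Walk G d u v) k → Walk G d u (at p k)
  at-walk stay       k       = stay
  at-walk (step a p) zero    = stay
  at-walk (step a p) (suc k) = step a (at-walk p k)

  walk-lipschitz : (f : Fin n → ℕ) → (∀ {u v} → Adj G u v → f v ≤ suc (f u)) →
                   ∀ {d u v} → Walk G d u v → f v ≤ f u + d
  walk-lipschitz f lip {d} stay = ℕ.m≤m+n _ d
  walk-lipschitz f lip {suc d} {u} {v} (step {w = w} a p) = begin
    f v             ≤⟨ walk-lipschitz f lip p ⟩
    f w + d         ≤⟨ ℕ.+-monoˡ-≤ d (lip a) ⟩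
    suc (f u + d)   ≡⟨ ℕ.+-suc _ d ⟨
    f u + suc d     ∎
    where open ℕ.≤-Reasoning

  module _ (N : ℕ) where
    open Truncated G N

    -- The position of a vertex on a shortest walk is its distance from the start.
    geodesic : ∀ x {d u v} (p : Walk G d u v) → tdist x u + d ≤ tdist x v → ∀ k →
               tdist x u ≤ tdist x (at p k) × at p (tdist x (at p k) ∸ tdist x u) ≡ at p k
    geodesic x stay _ k = ℕ.≤-refl , refl
    geodesic x {u = u} (step a p) _ zero = ℕ.≤-refl , lem
      where
      lem : at (step {G = G} a p) (tdist x u ∸ tdist x u) ≡ u
      lem rewrite ℕ.n∸n≡0 (tdist x u) = refl
    geodesic x {suc d} {u} {v} (step {w = w} a p) geo (suc k) = ℕ.<⇒≤ u<y , lem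
      where
      y = at p k
      -- The remaining `d` steps raise the distance by at most `d`, so this step must raise it by
      -- exactly one.
      w≡ : tdist x w ≡ suc (tdist x u)
      w≡ = ℕ.≤-antisym (tdist-lipschitz x a)
             (ℕ.+-cancelʳ-≤ d _ _ (ℕ.≤-trans (ℕ.≤-reflexive (sym (ℕ.+-suc _ d)))
                                    (ℕ.≤-trans geo (walk-lipschitz (tdist x) (tdist-lipschitz x) p))))
      ih = geodesic x p (ℕ.≤-trans (ℕ.≤-reflexive (trans (cong (_+ d) w≡) (sym (ℕ.+-suc _ d)))) geo) k
      u<y : tdist x u < tdist x y
      u<y = subst (_≤ tdist x y) w≡ (proj₁ ih)
      lem : at (step {G = G} a p) (tdist x y ∸ tdist x u) ≡ y
      lem = trans (cong (at (step {G = G} a p)) (ℕ.+-∸-assoc 1 u<y))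
                  (trans (cong (λ s → at p (tdist x y ∸ s)) (sym w≡)) (proj₂ ih))

unique-lookup : ∀ {A : Set} {xs : List A} → Unique xs → ∀ {i j} → List.lookup xs i ≡ List.lookup xs j → i ≡ j
unique-lookup (x∉ ∷ xs!) {zero}  {zero}  eq = refl
unique-lookup (x∉ ∷ xs!) {zero}  {suc j} eq = contradiction eq (All.lookup x∉ (List.∈-lookup j))
unique-lookup (x∉ ∷ xs!) {suc i} {zero}  eq = contradiction (sym eq) (All.lookup x∉ (List.∈-lookup i))
unique-lookup (x∉ ∷ xs!) {suc i} {suc j} eq = cong suc (unique-lookup xs! eq)

-- The given element of `C` fills the indices left over when `xs` is shorter than `q`.
choose-few : ∀ {A B : Set} {C : B → Set} {Q : A → B → Set} {xs : List A} q → ∃ C → length xs ≤ q →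
             All (λ x → ∃[ b ] C b × Q x b) xs →
             ∃ λ (f : Fin q → B) → (∀ m → C (f m)) × All (λ x → ∃ λ m → Q x (f m)) xs
choose-few q (b , c) _ [] = (λ _ → b) , (λ _ → c) , []
choose-few (suc q) bc (s≤s le) ((b , c , qb) ∷ ps) with f , cf , qs ← choose-few q bc le ps =
  (λ { zero → b ; (suc m) → f m }) , (λ { zero → c ; (suc m) → cf m }) ,
  (zero , qb) ∷ All.map (λ (m , qm) → suc m , qm) qs

module _ {n} (G : Graph n) where

  -- Some vertex of π ⁻¹(j), j < i, has a neighbour in the component of a in π ⁻¹[i, ∞).
  Nb : (Fin n → ℕ) → ℕ → Fin n → ℕ → Set
  Nb π i a j = i ≤ π a × j < i × ∃₂ λ c w → Walk (above G π i) n a c × Adj G c w × π w ≡ j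

  nb? : ∀ π i a j → Dec (Nb π i a j)
  nb? π i a j = i ℕ.≤? π a ×-dec j ℕ.<? i ×-dec
    any? λ c → any? λ w → walk? (above G π i) n a c ×-dec adj? G c w ×-dec π w ℕ.≟ j

  above-⊑ : ∀ {π i} → above G π i ⊑ G
  above-⊑ (_ , _ , a) = a

  above-mono : ∀ {π i j} → i ≤ j → above G π j ⊑ above G π i
  above-mono i≤j (pu , pv , a) = ℕ.≤-trans i≤j pu , ℕ.≤-trans i≤j pv , a

  walk-above : ∀ {π i d u v} → i ≤ π u → Walk (above G π i) d u v → i ≤ π v
  walk-above i≤ stay                = i≤
  walk-above _  (step (_ , i≤ , _) p) = walk-above i≤ p

  -- Parts numbered below `t` are final; everything else may be renumbered from `t` upwards.
  Agree : ℕ → (Fin n → ℕ) → (Fin n → ℕ) → Set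
  Agree t π π′ = ∀ v → π v < t × π′ v ≡ π v ⊎ t ≤ π v × t ≤ π′ v

  module _ {t π π′} (agree : Agree t π π′) where

    agree-≤ : ∀ {v} → t ≤ π′ v → t ≤ π v
    agree-≤ {v} t≤ with agree v
    ... | inj₁ (lt , eq) = contradiction (ℕ.≤-trans t≤ (ℕ.≤-reflexive eq)) (ℕ.<⇒≱ lt)
    ... | inj₂ (t≤ , _)  = t≤

    agree-< : ∀ {v} → π′ v < t → π v ≡ π′ v
    agree-< {v} lt with agree v
    ... | inj₁ (_ , eq) = sym eq
    ... | inj₂ (_ , t≤) = contradiction t≤ (ℕ.<⇒≱ lt)

    agree-<ʳ : ∀ {v} → π v < t → π′ v ≡ π v
    agree-<ʳ {v} lt with agree v
    ... | inj₁ (_ , eq) = eq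
    ... | inj₂ (t≤ , _) = contradiction t≤ (ℕ.<⇒≱ lt)

    agree-⊑ : above G π′ t ⊑ above G π t
    agree-⊑ (pu , pv , a) = agree-≤ pu , agree-≤ pv , a

    agree-nb : ∀ {a j} → Nb π′ t a j → Nb π t a j
    agree-nb (t≤ , j<t , c , w , p , a , refl) = agree-≤ t≤ , j<t , c , w , walk-⊑ agree-⊑ p , a , agree-< j<t

  nb-down : ∀ {π i j a k} → i ≤ j → k < i → Nb π j a k → Nb π i a k
  nb-down i≤j k<i (j≤ , _ , c , w , p , a , eq) =
    ℕ.≤-trans i≤j j≤ , k<i , c , w , walk-⊑ (above-mono i≤j) p , a , eq

  -- The invariant of the construction after `t` parts; `π v ≡ t` marks the vertices that are not
  -- yet placed.
  record State (π : Fin n → ℕ) (t : ℕ) : Set where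
    field
      bounded : ∀ v → π v ≤ t
      conn    : ∀ {u v} → π u < t → π v ≡ π u → Star (Inside G (λ x → π x ≡ π u)) u v
      clique  : ∀ {a j k} → j ≢ k → Nb π t a j → Nb π t a k → ∃₂ λ u v → π u ≡ j × π v ≡ k × Adj G u v

  NbBound : (Fin n → ℕ) → ℕ → ℕ → Set
  NbBound π i q = ∀ {a K} → Unique K → All (Nb π i a) K → length K ≤ q

  -- The component of a and the parts next to it are the branch sets of a complete minor.
  state⇒nb-bound : ∀ {π t q} → ¬ Complete (2 + q) MinorOf G → State π t → NbBound π t q
  state⇒nb-bound {π} {t} {q} ¬minor st {a} {K} K! nbs with length K ℕ.≤? q
  ... | yes le = le
  ... | no  gt = contradiction (complete-minor G B B? root root∈ connB disj edge) ¬minor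
    where
    open State st
    H = above G π t

    Comp : Fin n → Set
    Comp v = Walk H n a v

    -- The first `suc q` entries of `K` and the component of `a` make `2 + q` branch sets.
    part : Fin (suc q) → ℕ
    part m = List.lookup K (inject≤ m (ℕ.≰⇒> gt))

    nb : ∀ m → Nb π t a (part m)
    nb m = All.lookup nbs (List.∈-lookup (inject≤ m (ℕ.≰⇒> gt)))

    t≤a : t ≤ π a
    t≤a = proj₁ (nb zero)

    B : Fin (2 + q) → Fin n → Set
    B zero    v = Comp v
    B (suc m) v = π v ≡ part m

    B? : ∀ m v → Dec (B m v)
    B? zero    v = walk? H n a v
    B? (suc m) v = π v ℕ.≟ part m

    root : Fin (2 + q) → Fin n
    root zero    = a
    root (suc m) = let _ , _ , _ , w , _ = nb m in w

    root∈ : ∀ m → B m (root m)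
    root∈ zero    = stay
    root∈ (suc m) = let _ , _ , _ , _ , _ , _ , eq = nb m in eq

    comp-star : ∀ {u v d} → Comp u → Walk H d u v → Star (Inside G Comp) u v
    comp-star cu stay       = ε
    comp-star cu (step e p) =
      let cw = walk-shorten H (walk-snoc cu e) in (cu , cw , above-⊑ {π} {t} e) ◅ comp-star cw p

    connB : ∀ m {v} → B m v → Star (Inside G (B m)) (root m) v
    connB zero    c  = comp-star stay c
    connB (suc m) eq = let _ , j<t , _ , w , _ , _ , w≡ = nb m in
      subst (λ j → Star (Inside G (λ x → π x ≡ j)) w _) w≡
        (conn (subst (_< t) (sym w≡) j<t) (trans eq (sym w≡)))

    disj : ∀ {i j v} → B i v → B j v → i ≡ j
    disj {zero}  {zero}  _ _ = refl
    disj {zero}  {suc j} c eq = contradiction (walk-above t≤a c) (ℕ.<⇒≱ (subst (_< t) (sym eq) (proj₁ (proj₂ (nb j)))))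
    disj {suc i} {zero}  eq c = contradiction (walk-above t≤a c) (ℕ.<⇒≱ (subst (_< t) (sym eq) (proj₁ (proj₂ (nb i)))))
    disj {suc i} {suc j} eq eq′ =
      cong suc (inject≤-injective _ _ i j (unique-lookup K! (trans (sym eq) eq′)))

    edge : ∀ {i j} → i ≢ j → ∃₂ λ u v → B i u × B j v × Adj G u v
    edge {zero}  {zero}  i≢j = contradiction refl i≢j
    edge {zero}  {suc j} _   = let _ , _ , c , w , p , e , eq = nb j in c , w , p , eq , e
    edge {suc i} {zero}  _   = let _ , _ , c , w , p , e , eq = nb i in w , c , eq , p , symm G e
    edge {suc i} {suc j} i≢j =
      clique (λ eq → i≢j (cong suc (inject≤-injective _ _ i j (unique-lookup K! eq)))) (nb i) (nb j)

module Layering {n} (G : Graph n) (p′ : ℕ) (¬minor : ¬ Complete (4 + p′) MinorOf G) where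

  private
    -- With `h = 4 + p′` this is `h - 3`, the number of shortest walks in a part. A component has at
    -- most `suc p`, that is `h - 2`, neighbouring parts.
    p : ℕ
    p = suc p′

  -- All that is kept of the shortest walks: `piece` tells the walk and `level` the distance from
  -- the root. As `level` is Lipschitz on all of {π ≥ i}, a ball there meets a piece in few
  -- vertices.
  record Pieces (π : Fin n → ℕ) (i : ℕ) : Set where
    field
      piece     : Fin n → Fin p
      level     : Fin n → ℕ
      lipschitz : ∀ {u v} → Adj (above G π i) u v → level v ≤ suc (level u)
      injective : ∀ {u v} → π u ≡ i → π v ≡ i → piece u ≡ piece v → level u ≡ level v → u ≡ v

  -- The part split off from the component of a₀ is the union of the shortest walks
  -- from the vertex f 0 to the vertices f (suc m), where every part next to
  -- the component has a neighbour among the f m.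
  module Step {π t} (st : State G π t) {a₀} (a₀≡t : π a₀ ≡ t) where
    open State st

    H : Graph n
    H = above G π t

    open Truncated H n

    comp≡t : ∀ {v d} → Walk H d a₀ v → π v ≡ t
    comp≡t c = ℕ.≤-antisym (bounded _) (walk-above G (ℕ.≤-reflexive (sym a₀≡t)) c)

    neighbours : List ℕ
    neighbours = filter (nb? G π t a₀) (upTo t)

    abstract
      -- One vertex for each of the at most `suc p` neighbouring parts, with `a₀` as the default.
      -- One of these vertices becomes the root, so that `p` walks suffice.
      chosen : ∃ λ (f : Fin (suc p) → Fin n) → (∀ m → Walk H n a₀ (f m)) ×
               All (λ j → ∃ λ m → ∃ λ w → Adj G (f m) w × π w ≡ j) neighbours
      chosen = choose-few {C = Walk H n a₀} {Q = λ j c → ∃ λ w → Adj G c w × π w ≡ j} (suc p) (a₀ , stay)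
        (state⇒nb-bound G ¬minor st (Unique.filter⁺ (nb? G π t a₀) (Unique.upTo⁺ t)) (All.all-filter (nb? G π t a₀) (upTo t)))
        (All.map (λ (_ , _ , c , w , r , e , eq) → c , r , w , e , eq) (All.all-filter (nb? G π t a₀) (upTo t)))

    f : Fin (suc p) → Fin n
    f = proj₁ chosen

    comp-f : ∀ m → Walk H n a₀ (f m)
    comp-f = proj₁ (proj₂ chosen)

    abstract
      geo : ∀ m → Walk H (tdist (f zero) (f (suc m))) (f zero) (f (suc m))
      geo m with tdist-walk (f zero) (f (suc m))
      ... | inj₁ r  = r
      -- Even the truncation value `n` is the length of a walk, since both ends lie in the component
      -- of `a₀`.
      ... | inj₂ eq = walk-≤ (ℕ.≤-reflexive (sym eq)) (walk-shorten H (walk-trans (walk-sym (comp-f zero)) (comp-f (suc m))))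

    level : Fin n → ℕ
    level = tdist (f zero)

    -- On a shortest walk from the root, a vertex can be found at the position given by its level,
    -- so this one equation tests whether it is on the walk.
    On : Fin p → Fin n → Set
    On m v = at (geo m) (level v) ≡ v

    Z : Fin n → Set
    Z v = ∃ λ m → On m v

    abstract
      z? : ∀ v → Dec (Z v)
      z? v = any? λ m → at (geo m) (level v) ≟ v

    level-root : level (f zero) ≡ 0
    level-root = ℕ.n≤0⇒n≡0 (tdist≤ 0 stay)

    on-at : ∀ m k → On m (at (geo m) k)
    on-at m k = subst (λ s → at (geo m) (level (at (geo m) k) ∸ s) ≡ at (geo m) k) level-root
      (proj₂ (geodesic n (f zero) (geo m) (ℕ.≤-reflexive (cong (_+ level (f (suc m))) level-root)) k))

    z-f : ∀ m → Z (f m)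
    z-f zero    = zero , subst (On zero) (at-first (geo zero)) (on-at zero 0)
    z-f (suc m) = m , subst (On m) (at-last (geo m)) (on-at m _)

    z-star : ∀ {v} → Z v → Star (Inside G Z) (f zero) v
    z-star {v} (m , on) = subst (Star _ _) on (go (level v))
      where
      go : ∀ k → Star (Inside G Z) (f zero) (at (geo m) k)
      go zero = subst (Star _ _) (sym (at-first (geo m))) ε
      go (suc k) with at-next (geo m) k
      ... | inj₁ eq = subst (Star _ _) eq (go k)
      ... | inj₂ (_ , _ , e) = go k ◅◅ ((m , on-at m k) , (m , on-at m (suc k)) , e) ◅ ε

    z-comp : ∀ {v} → Z v → Walk H n a₀ v
    z-comp (m , on) = walk-shorten H (walk-trans (comp-f zero) (subst (Walk H _ _) on (at-walk (geo m) _)))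

    reassign : ∀ {v} → Dec (Z v) → Dec (π v ≡ t) → ℕ
    reassign     (yes _) _       = t
    reassign     (no _)  (yes _) = suc t
    reassign {v} (no _)  (no _)  = π v

    π′ : Fin n → ℕ
    π′ v = reassign (z? v) (π v ℕ.≟ t)

    data View (v : Fin n) (i : ℕ) : Set where
      new  : Z v → π v ≡ t → i ≡ t → View v i
      rest : ¬ Z v → π v ≡ t → i ≡ suc t → View v i
      old  : π v < t → i ≡ π v → View v i

    view′ : ∀ {v} (z : Dec (Z v)) (e : Dec (π v ≡ t)) → View v (reassign z e)
    view′     (yes z) _        = new z (comp≡t (z-comp z)) refl
    view′     (no ¬z) (yes eq) = rest ¬z eq refl
    view′ {v} (no _)  (no ≢t)  = old (ℕ.≤∧≢⇒< (bounded v) ≢t) refl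

    view : ∀ v → View v (π′ v)
    view v = view′ (z? v) (π v ℕ.≟ t)

    agree : Agree G t π π′
    agree v with view v
    ... | new _ eq eq′  = inj₂ (ℕ.≤-reflexive (sym eq) , ℕ.≤-reflexive (sym eq′))
    ... | rest _ eq eq′ = inj₂ (ℕ.≤-reflexive (sym eq) , ℕ.≤-trans (ℕ.n≤1+n t) (ℕ.≤-reflexive (sym eq′)))
    ... | old lt eq     = inj₁ (lt , eq)

    z⇒≡t : ∀ {v} → Z v → π′ v ≡ t
    z⇒≡t {v} z with view v
    ... | new _ _ eq  = eq
    ... | rest ¬z _ _ = contradiction z ¬z
    ... | old lt _    = contradiction (comp≡t (z-comp z)) (ℕ.<⇒≢ lt)

    ≡t⇒z : ∀ {v} → π′ v ≡ t → Z v
    ≡t⇒z {v} eq with view v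
    ... | new z _ _    = z
    ... | rest _ _ eq′ = contradiction (trans (sym eq′) eq) ℕ.1+n≢n
    ... | old lt eq′   = contradiction (trans (sym eq′) eq) (ℕ.<⇒≢ lt)

    walk-of : ∀ {v} → Dec (Z v) → Fin p
    walk-of (yes (m , _)) = m
    walk-of (no _)        = zero

    piece : Fin n → Fin p
    piece v = walk-of (z? v)

    on-walk : ∀ {v} → Z v → (z : Dec (Z v)) → On (walk-of z) v
    on-walk _ (yes (_ , on)) = on
    on-walk z (no ¬z)        = contradiction z ¬z

    on-piece : ∀ {v} → Z v → On (piece v) v
    on-piece {v} z = on-walk z (z? v)

    piece-injective : ∀ {u v} → Z u → Z v → piece u ≡ piece v → level u ≡ level v → u ≡ v
    piece-injective {u} {v} zu zv eqp eql = begin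
      u                             ≡⟨ on-piece zu ⟨
      at (geo (piece u)) (level u)  ≡⟨ cong₂ (λ m → at (geo m)) eqp eql ⟩
      at (geo (piece v)) (level v)  ≡⟨ on-piece zv ⟩
      v                             ∎
      where open ≡-Reasoning

    -- A component next to the new part lies in the component of a₀.
    joined : ∀ {a j} → Nb G π′ (suc t) a t → Nb G π t a j → ∃₂ λ u v → π′ u ≡ t × π v ≡ j × Adj G u v
    joined {a} (st≤a , _ , c , z , r , e , z≡t) (t≤ , j<t , c′ , w , r′ , e′ , eq) =
      let comp-z = z-comp (≡t⇒z z≡t)
          r₁     = walk-⊑ {G = above G π′ t} {H = H} (agree-⊑ G agree)
                     (walk-⊑ {G = above G π′ (suc t)} {H = above G π′ t} (above-mono G (ℕ.n≤1+n t)) r)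
          t≤c    = walk-above G t≤ r₁
          t≤z    = ℕ.≤-reflexive (sym (comp≡t comp-z))
          to-c   = walk-snoc comp-z (t≤z , t≤c , symm G e)
          to-c′  = walk-shorten H (walk-trans (walk-trans to-c (walk-sym r₁)) r′)
          nb     = ℕ.≤-reflexive (sym a₀≡t) , j<t , c′ , w , to-c′ , e′ , eq
          -- Part `j` is next to the component of `a₀`, so it is adjacent to some `f m`, which
          -- belongs to the new part.
          m , w′ , e″ , eq″ = All.lookup (proj₂ (proj₂ chosen))
                                (List.∈-filter⁺ (nb? G π t a₀) (List.∈-upTo⁺ j<t) nb)
      in f m , w′ , z⇒≡t (z-f m) , eq″ , e″

    state′ : State G π′ (suc t)
    state′ = record { bounded = bounded′ ; conn = conn′ ; clique = clique′ }
      where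
      bounded′ : ∀ v → π′ v ≤ suc t
      bounded′ v with view v
      ... | new _ _ eq  = ℕ.≤-trans (ℕ.≤-reflexive eq) (ℕ.n≤1+n t)
      ... | rest _ _ eq = ℕ.≤-reflexive eq
      ... | old lt eq   = ℕ.≤-trans (ℕ.≤-reflexive eq) (ℕ.≤-trans (ℕ.<⇒≤ lt) (ℕ.n≤1+n t))

      conn′ : ∀ {u v} → π′ u < suc t → π′ v ≡ π′ u → Star (Inside G (λ x → π′ x ≡ π′ u)) u v
      conn′ {u} {v} lt eq with view u
      ... | rest _ _ eq′ = contradiction (ℕ.≤-trans lt (ℕ.≤-reflexive (sym eq′))) ℕ.1+n≰n
      ... | new zu _ eq′ =
        Star.map (λ (zx , zy , e) → trans (z⇒≡t zx) (sym eq′) , trans (z⇒≡t zy) (sym eq′) , e)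
          (Star.reverse (λ (zx , zy , e) → zy , zx , symm G e) (z-star zu) ◅◅ z-star (≡t⇒z (trans eq eq′)))
      ... | old lt′ eq′ =
        Star.map (λ (x≡ , y≡ , e) → lift x≡ , lift y≡ , e)
          (conn lt′ (trans (agree-< G agree (ℕ.≤-trans (s≤s (ℕ.≤-reflexive (trans eq eq′))) lt′)) (trans eq eq′)))
        where
        lift : ∀ {x} → π x ≡ π u → π′ x ≡ π′ u
        lift x≡ = trans (agree-<ʳ G agree (subst (_< t) (sym x≡) lt′)) (trans x≡ (sym eq′))

      old-nb : ∀ {a j} → j < t → Nb G π′ (suc t) a j → Nb G π t a j
      old-nb j<t nb = agree-nb G agree (nb-down G (ℕ.n≤1+n t) j<t nb)

      lift : ∀ {j v} → j < t → π v ≡ j → π′ v ≡ j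
      lift j<t refl = agree-<ʳ G agree j<t

      clique′ : ∀ {a j k} → j ≢ k → Nb G π′ (suc t) a j → Nb G π′ (suc t) a k →
                ∃₂ λ u v → π′ u ≡ j × π′ v ≡ k × Adj G u v
      clique′ j≢k nbj@(_ , j<st , _) nbk@(_ , k<st , _)
        with ℕ.m≤n⇒m<n∨m≡n (s≤s⁻¹ j<st) | ℕ.m≤n⇒m<n∨m≡n (s≤s⁻¹ k<st)
      ... | inj₁ j<t  | inj₁ k<t  =
        let u , v , u≡ , v≡ , e = clique j≢k (old-nb j<t nbj) (old-nb k<t nbk)
        in u , v , lift j<t u≡ , lift k<t v≡ , e
      ... | inj₂ refl | inj₁ k<t  =
        let u , v , u≡ , v≡ , e = joined nbj (old-nb k<t nbk) in u , v , u≡ , lift k<t v≡ , e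
      ... | inj₁ j<t  | inj₂ refl =
        let u , v , u≡ , v≡ , e = joined nbk (old-nb j<t nbj) in v , u , lift j<t v≡ , u≡ , symm G e
      ... | inj₂ refl | inj₂ refl = contradiction refl j≢k

    root≡t : π (f zero) ≡ t
    root≡t = comp≡t (comp-f zero)

    root-new : π′ (f zero) ≡ t
    root-new = z⇒≡t (z-f zero)

    -- The measure for `layer`: the root leaves the set of unplaced vertices.
    shrinks : satisfying (λ v → π′ v ℕ.≟ suc t) ⊂ satisfying (λ v → π v ℕ.≟ t)
    shrinks = (λ {v} v∈ → ∈-satisfying⁺ (λ v → π v ℕ.≟ t) (from (∈-satisfying⁻ (λ v → π′ v ℕ.≟ suc t) v∈))) ,
      f zero , ∈-satisfying⁺ (λ v → π v ℕ.≟ t) root≡t ,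
      λ r∈ → ℕ.1+n≢n (trans (sym (∈-satisfying⁻ (λ v → π′ v ℕ.≟ suc t) r∈)) root-new)
      where
      from : ∀ {v} → π′ v ≡ suc t → π v ≡ t
      from {v} eq with view v
      ... | new _ eq′ _  = eq′
      ... | rest _ eq′ _ = eq′
      ... | old lt eq′   = contradiction (trans (sym eq′) eq) (ℕ.<⇒≢ (ℕ.m≤n⇒m≤1+n lt))

  Layered : (Fin n → ℕ) → ℕ → Set
  Layered π t = ∀ i → t ≤ i → Pieces π i × NbBound G π i (suc p)

  -- Part `t` is settled by the present step. Its pieces and its bound on neighbours carry over to
  -- the final `π*` because {π* ≥ t} is contained in {π ≥ t}. Later parts come from the recursive
  -- call.
  layer : ∀ {π t} → State G π t → Acc _⊂_ (satisfying (λ v → π v ℕ.≟ t)) →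
          ∃ λ π* → Agree G t π π* × Layered π* t
  layer {π} {t} st (acc rec) with any? (λ v → π v ℕ.≟ t)
  -- All vertices are placed, so the parts from `t` on are empty and arbitrary pieces and levels
  -- will do.
  ... | no ¬a₀ = π , (λ v → inj₁ (below v , refl)) , λ i t≤i →
        record { piece = λ _ → zero ; level = λ _ → 0 ; lipschitz = λ _ → z≤n
               ; injective = λ {u} u≡i → contradiction (ℕ.≤-trans t≤i (ℕ.≤-reflexive (sym u≡i))) (ℕ.<⇒≱ (below u)) } ,
        λ { [] [] → z≤n
          ; {a} (_ ∷ _) ((i≤ , _) ∷ _) → contradiction (ℕ.≤-trans t≤i i≤) (ℕ.<⇒≱ (below a)) }
    where
    below : ∀ v → π v < t
    below v = ℕ.≤∧≢⇒< (State.bounded st v) λ eq → ¬a₀ (v , eq)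
  ... | yes (a₀ , a₀≡t) with π* , agree′ , lay ← layer (Step.state′ st a₀≡t) (rec (Step.shrinks st a₀≡t)) =
    π* , agree* , layered
    where
    open Step st a₀≡t
    agree* : Agree G t π π*
    agree* v with agree′ v | view v
    ... | inj₁ (_ , eq)  | new _ eqt eq′  = inj₂ (ℕ.≤-reflexive (sym eqt) , ℕ.≤-reflexive (sym (trans eq eq′)))
    ... | inj₁ (lt , _)  | rest _ _ eq′   = contradiction (ℕ.≤-trans lt (ℕ.≤-reflexive (sym eq′))) ℕ.1+n≰n
    ... | inj₁ (_ , eq)  | old lt eq′     = inj₁ (lt , trans eq eq′)
    ... | inj₂ (st≤ , _) | new _ _ eq′    = contradiction (ℕ.≤-trans st≤ (ℕ.≤-reflexive eq′)) ℕ.1+n≰n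
    ... | inj₂ (_ , st≤) | rest _ eqt _   = inj₂ (ℕ.≤-reflexive (sym eqt) , ℕ.≤-trans (ℕ.n≤1+n t) st≤)
    ... | inj₂ (st≤ , _) | old lt eq′     =
      contradiction (ℕ.≤-trans (ℕ.n≤1+n _) (ℕ.≤-trans st≤ (ℕ.≤-reflexive eq′))) (ℕ.<⇒≱ lt)

    *≡t⇒z : ∀ {v} → π* v ≡ t → Z v
    *≡t⇒z eq = ≡t⇒z (trans (agree-< G agree′ (ℕ.≤-reflexive (cong suc eq))) eq)

    layered : Layered π* t
    layered i t≤i with ℕ.m≤n⇒m<n∨m≡n t≤i
    ... | inj₁ t<i  = lay i t<i
    ... | inj₂ refl =
      record { piece = piece ; level = level
             ; lipschitz = λ e → Truncated.tdist-lipschitz H n (f zero) (agree-⊑ G agree* e)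
             ; injective = λ u≡ v≡ → piece-injective (*≡t⇒z u≡) (*≡t⇒z v≡) } ,
      λ K! nbs → state⇒nb-bound G ¬minor st K! (All.map (agree-nb G agree*) nbs)

  layering : ∃ λ π → Layered π 0
  layering with π , _ , lay ← layer {λ _ → 0} {0}
                  (record { bounded = λ _ → z≤n ; conn = λ () ; clique = λ { _ (_ , () , _) } })
                  (⊂-wellFounded _) = π , lay

-- Counting the parts reached from a vertex

module _ {n} (G : Graph n) (π : Fin n → ℕ) where

  -- A walk cut at its first edge out of {π ≥ i}; `H` records the subgraph in which the rest of the
  -- walk runs.
  record Exit (H : Graph n) (i D : ℕ) (a y : Fin n) : Set where
    constructor exit-at
    field
      {len₁ len₂}   : ℕ
      {inner outer} : Fin n
      before      : Walk (above G π i) len₁ a inner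
      edge        : Adj H inner outer
      below       : π outer < i
      after       : Walk H len₂ outer y
      lengths     : suc len₁ + len₂ ≤ D

  exit : ∀ {H i D a y} → H ⊑ G → i ≤ π a → Walk H D a y → Walk (above G π i) D a y ⊎ Exit H i D a y
  exit         H⊑G i≤a stay = inj₁ stay
  exit {i = i} H⊑G i≤a (step {w = w} e p) with π w ℕ.<? i
  ... | yes lt = inj₂ (exit-at stay e lt p ℕ.≤-refl)
  ... | no  ge with exit H⊑G (ℕ.≮⇒≥ ge) p
  ...   | inj₁ p′ = inj₁ (step (i≤a , ℕ.≮⇒≥ ge , H⊑G e) p′)
  ...   | inj₂ (exit-at p₁ e′ lt p₂ le) = inj₂ (exit-at (step (i≤a , ℕ.≮⇒≥ ge , H⊑G e) p₁) e′ lt p₂ (s≤s le))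

  Reaches : Fin n → ℕ → ℕ → Set
  Reaches a d i = ∃ λ y → π y ≡ i × Walk (above G π i) d a y

  reaches? : ∀ a d i → Dec (Reaches a d i)
  reaches? a d i = any? λ y → π y ℕ.≟ i ×-dec walk? (above G π i) d a y

  reaches-mono : ∀ {a d e i} → d ≤ e → Reaches a d i → Reaches a e i
  reaches-mono d≤e (y , eq , p) = y , eq , walk-≤ d≤e p

  reaches⇒≤ : ∀ {a d i} → Reaches a d i → i ≤ π a
  reaches⇒≤ (y , eq , p) = walk-above G (ℕ.≤-reflexive (sym eq)) (walk-sym p)

  -- Where a walk to part `j` first leaves {π ≥ i}, it enters a part `k` next to the component of
  -- `a`. If steps remain after that, `k` was reached in fewer than `d` steps.
  first-part : ∀ {a d i j} → i ≤ π a → j < i → Reaches a d j →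
               ∃ λ k → Nb G π i a k × j ≤ k × (k ≡ j ⊎ ∃ λ e → e < d × Reaches a e k)
  first-part {i = i} {j} i≤a j<i (y , refl , p) with exit {i = i} (above-⊑ G {π} {j}) i≤a p
  ... | inj₁ q = contradiction (walk-above G i≤a q) (ℕ.<⇒≱ j<i)
  ... | inj₂ (exit-at {len₁} {len₂} {c} {w} q e@(_ , j≤w , e′) w<i q′ le) =
    π w , (i≤a , w<i , c , w , walk-shorten (above G π i) q , e′ , refl) , j≤w , same len₂ q′ le
    where
    same : ∀ l → Walk (above G π j) l w y → suc len₁ + l ≤ _ → π w ≡ j ⊎ ∃ λ e → e < _ × Reaches _ e (π w)
    same zero    stay _  = inj₁ refl
    same (suc l) _    le = inj₂ (suc len₁ , ℕ.≤-trans (s≤s (ℕ.≤-trans (ℕ.m≤m+n (suc len₁) l)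
                                    (ℕ.≤-reflexive (sym (ℕ.+-suc len₁ l))))) le , w , refl ,
      walk-snoc (walk-⊑ (above-mono G (ℕ.<⇒≤ w<i)) q)
        (ℕ.≤-trans (ℕ.<⇒≤ w<i) (walk-above G i≤a q) , ℕ.≤-refl , e′))

  module _ {T} (nb-bound : ∀ i → NbBound G π i T) (a : Fin n) (r : ℕ) where

    -- K consists of known neighbouring parts below lo, so that at most q more may show up in [lo, i).
    count : ∀ ρ q {d i lo K L} → d + ρ ≡ r → i ≤ π a →
            Unique K → All (Nb G π i a) K → All (_< lo) K → T ≤ q + length K →
            (∀ {j} → lo ≤ j → j < i → ¬ Reaches a d j) →
            Unique L → All (λ j → lo ≤ j × j < i × Reaches a r j) L →
            suc (length L) ≤ suc ρ ^ q
    count ρ q {L = []} _ _ _ _ _ _ _ _ _ = ℕ.m^n>0 (suc ρ) q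
    count zero q {d} d≡r _ _ _ _ _ far _ ((lo≤j , j<i , re) ∷ _) =
      contradiction (subst (λ e → Reaches a e _) (sym (trans (sym (ℕ.+-identityʳ d)) d≡r)) re) (far lo≤j j<i)
    -- `K` already has `T` neighbouring parts, all below `lo`, but `first-part` yields another one
    -- at or above `lo`.
    count (suc ρ) zero d≡r i≤a K! nbs K<lo T≤ far _ ((lo≤j , j<i , re) ∷ _)
      with k , nbk , j≤k , _ ← first-part i≤a j<i re =
      contradiction (ℕ.≤-trans (nb-bound _ (All.map (λ lt eq → ℕ.<⇒≢ (ℕ.<-≤-trans lt (ℕ.≤-trans lo≤j j≤k)) (sym eq)) K<lo ∷ K!)
                                           (nbk ∷ nbs)) T≤) ℕ.1+n≰n
    -- Looks for the least part `x` in [lo, i) reached within `suc d` steps. Without one, `ρ` drops.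
    -- Otherwise, `ρ` drops on [lo, x), while on (x, i) the part `x` becomes a known neighbour and
    -- `q` drops.
    count (suc ρ) (suc q) {d} {i} {lo} {K} {L@(_ ∷ _)} d≡r i≤a K! nbs K<lo T≤ far L! Ls
      with first-view (reaches? a (suc d)) (lo +_) (i ∸ lo)
    ... | none _ none′ =
      ℕ.≤-trans (count ρ (suc q) (trans (sym (ℕ.+-suc d ρ)) d≡r) i≤a K! nbs K<lo T≤ far′ L! Ls)
                (ℕ.^-monoˡ-≤ (suc q) (ℕ.n≤1+n (suc ρ)))
      where
      far′ : ∀ {j} → lo ≤ j → j < i → ¬ Reaches a (suc d) j
      far′ {j} lo≤j j<i re = none′ (ℕ.∸-monoˡ-< j<i lo≤j)
        (subst (Reaches a (suc d)) (sym (ℕ.m+[n∸m]≡n lo≤j)) re)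
    ... | found k _ k< re min = begin
      suc (length L)                                ≤⟨ s≤s (length-split-at x L!) ⟩
      suc (length L< + suc (length L>))             ≤⟨ ℕ.+-mono-≤ lower upper ⟩
      suc ρ * suc ρ ^ q + (2 + ρ) ^ q               ≤⟨ ℕ.+-monoˡ-≤ _ (ℕ.*-monoʳ-≤ (suc ρ) (ℕ.^-monoˡ-≤ q (ℕ.n≤1+n (suc ρ)))) ⟩
      suc ρ * (2 + ρ) ^ q + (2 + ρ) ^ q             ≡⟨ ℕ.+-comm _ ((2 + ρ) ^ q) ⟩
      (2 + ρ) ^ suc q                               ∎
      where
      open ℕ.≤-Reasoning
      x = lo + k
      L< = filter (ℕ._<? x) L
      L> = filter (x ℕ.<?_) L
      lo≤x : lo ≤ x
      lo≤x = ℕ.m≤m+n lo k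
      x<i : x < i
      x<i = ℕ.≤-trans (ℕ.+-monoʳ-< lo k<)
              (ℕ.≤-reflexive (ℕ.m+[n∸m]≡n (ℕ.<⇒≤ (ℕ.m∸n≢0⇒n<m {i} {lo} (λ eq → contradiction (subst (k <_) eq k<) λ ())))))
      -- If the walk entered another part first, that part would be in [x, i) and reached within `d`
      -- steps, against `far`.
      nbx : Nb G π i a x
      nbx with first-part i≤a x<i re
      ... | _ , nb , _   , inj₁ refl = nb
      ... | _ , nb , x≤k , inj₂ (e , e< , re′) =
        contradiction (reaches-mono (s≤s⁻¹ e<) re′) (far (ℕ.≤-trans lo≤x x≤k) (proj₁ (proj₂ nb)))
      lower : suc (length L<) ≤ suc ρ ^ suc q
      lower = count ρ (suc q) (trans (sym (ℕ.+-suc d ρ)) d≡r) (ℕ.≤-trans (ℕ.<⇒≤ x<i) i≤a) K!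
        (All.zipWith (λ (lt , nb) → nb-down G (ℕ.<⇒≤ x<i) (ℕ.<-≤-trans lt lo≤x) nb) (K<lo , nbs)) K<lo T≤
        (λ {j} lo≤j j<x re′ → ℕ.<⇒≱ (ℕ.+-cancelˡ-< lo _ _ (ℕ.≤-<-trans (ℕ.≤-reflexive (ℕ.m+[n∸m]≡n lo≤j)) j<x))
          (min (subst (Reaches a (suc d)) (sym (ℕ.m+[n∸m]≡n lo≤j)) re′)))
        (Unique.filter⁺ (ℕ._<? x) L!)
        (All.zipWith (λ (lt , (lo≤ , _ , re′)) → lo≤ , lt , re′) (All.all-filter (ℕ._<? x) L , All.filter⁺ (ℕ._<? x) Ls))
      upper : suc (length L>) ≤ (2 + ρ) ^ q
      upper = count (suc ρ) q {lo = suc x} d≡r i≤a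
        (All.map (λ lt eq → ℕ.<⇒≢ (ℕ.<-≤-trans lt lo≤x) (sym eq)) K<lo ∷ K!) (nbx ∷ nbs)
        (ℕ.≤-refl ∷ All.map (λ lt → ℕ.m≤n⇒m≤1+n (ℕ.<-≤-trans lt lo≤x)) K<lo)
        (ℕ.≤-trans T≤ (ℕ.≤-reflexive (sym (ℕ.+-suc q _))))
        (λ x<j j<i → far (ℕ.≤-trans lo≤x (ℕ.<⇒≤ x<j)) j<i)
        (Unique.filter⁺ (x ℕ.<?_) L!)
        (All.zipWith (λ (gt , (_ , lt , re′)) → gt , lt , re′) (All.all-filter (x ℕ.<?_) L , All.filter⁺ (x ℕ.<?_) Ls))

    -- `count` bounds the parts below `π a`; the `suc` in it makes room for the part of `a`, and no
    -- part above that is reached.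
    reached-parts : ∀ {L} → Unique L → All (Reaches a r) L → length L ≤ suc r ^ T
    reached-parts {L} L! Ls = begin
      length L                                      ≤⟨ length-split-at m L! ⟩
      length L< + suc (length (filter (m ℕ.<?_) L)) ≡⟨ cong (λ L → length L< + suc (length L)) empty ⟩
      length L< + 1                                 ≡⟨ ℕ.+-comm _ 1 ⟩
      suc (length L<)                               ≤⟨ count r T refl ℕ.≤-refl [] [] [] (ℕ.m≤m+n T 0)
                                                        (λ { _ j<a (_ , refl , stay) → ℕ.<-irrefl refl j<a })
                                                        (Unique.filter⁺ (ℕ._<? m) L!)
                                                        (All.zipWith (λ (lt , re) → z≤n , lt , re)
                                                          (All.all-filter (ℕ._<? m) L , All.filter⁺ (ℕ._<? m) Ls)) ⟩
      suc r ^ T                                     ∎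
      where
      open ℕ.≤-Reasoning
      m = π a
      L< = filter (ℕ._<? m) L
      empty : filter (m ℕ.<?_) L ≡ []
      empty = List.filter-none (m ℕ.<?_) (All.map (λ re → ℕ.≤⇒≯ (reaches⇒≤ re)) Ls)

-- Profiles

elements : ∀ {n} → Subset n → List (Fin n)
elements []            = []
elements (inside ∷ A)  = zero ∷ map suc (elements A)
elements (outside ∷ A) = map suc (elements A)

length-elements : ∀ {n} (A : Subset n) → length (elements A) ≡ ∣ A ∣
length-elements []            = refl
length-elements (inside ∷ A)  = cong suc (trans (List.length-map suc (elements A)) (length-elements A))
length-elements (outside ∷ A) = trans (List.length-map suc (elements A)) (length-elements A)

∈-elements : ∀ {n} {A : Subset n} {a} → a ∈ A → a List.∈ elements A
∈-elements {A = inside ∷ A}  Vec.here        = here refl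
∈-elements {A = inside ∷ A}  (Vec.there a∈A) = there (List.∈-map⁺ suc (∈-elements a∈A))
∈-elements {A = outside ∷ A} (Vec.there a∈A) = List.∈-map⁺ suc (∈-elements a∈A)

length-concatMap : ∀ {A B : Set} (f : A → List B) M → (∀ x → length (f x) ≤ M) →
                   ∀ xs → length (concatMap f xs) ≤ length xs * M
length-concatMap f M f≤ []       = z≤n
length-concatMap f M f≤ (x ∷ xs) = ℕ.≤-trans (ℕ.≤-reflexive (List.length-++ (f x)))
                                             (ℕ.+-mono-≤ (f≤ x) (length-concatMap f M f≤ xs))

length-cartesianProduct : ∀ {A B : Set} (xs : List A) (ys : List B) →
                          length (cartesianProduct xs ys) ≡ length xs * length ys
length-cartesianProduct []       ys = refl
length-cartesianProduct (x ∷ xs) ys =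
  trans (List.length-++ (map (x ,_) ys)) (cong₂ _+_ (List.length-map _ ys) (length-cartesianProduct xs ys))

-- On a walk, a vertex of minimal π is reached from both ends without going below it.
lowest : ∀ {n} {G H : Graph n} (π : Fin n → ℕ) → H ⊑ G → ∀ {d u v} → Walk H d u v →
         ∃ λ z → ∃₂ λ d₁ d₂ → d₁ + d₂ ≤ d × Walk H d₁ u z ×
         Walk (above G π (π z)) d₁ u z × Walk (above G π (π z)) d₂ v z
lowest π H⊑G {u = u} stay = u , 0 , 0 , z≤n , stay , stay , stay
lowest {G = G} {H} π H⊑G {u = u} (step {w = w} e p)
  with z , d₁ , d₂ , le , q , q₁ , q₂ ← lowest {G = G} {H} π H⊑G p
  with w≥z ← walk-above G ℕ.≤-refl (walk-sym q₁)
  with π z ℕ.≤? π u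
... | yes z≤u = z , suc d₁ , d₂ , s≤s le , step e q , step (z≤u , w≥z , H⊑G e) q₁ , q₂
... | no  z≰u = u , 0 , d₂ + suc d₁ ,
  ℕ.≤-trans (ℕ.≤-reflexive (trans (ℕ.+-suc d₂ d₁) (cong suc (ℕ.+-comm d₂ d₁)))) (s≤s le) , stay , stay ,
  walk-trans (lift q₂) (walk-snoc (lift (walk-sym q₁)) (ℕ.≤-trans u≤z w≥z , ℕ.≤-refl , symm G (H⊑G e)))
  where
  u≤z = ℕ.<⇒≤ (ℕ.≰⇒> z≰u)
  lift : ∀ {d x y} → Walk (above G π (π z)) d x y → Walk (above G π (π u)) d x y
  lift = walk-⊑ (above-mono G u≤z)

module Profiles {n} (G : Graph n) (p′ : ℕ) (¬minor : ¬ Complete (4 + p′) MinorOf G) (r : ℕ)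
                (π : Fin n → ℕ) (lay : Layering.Layered G p′ ¬minor π 0) where

  open Layering G p′ ¬minor using (Pieces; module Pieces)

  p : ℕ
  p = suc p′

  nb-bound : ∀ i → NbBound G π i (suc p)
  nb-bound i = proj₂ (lay i z≤n)

  module _ {i d : ℕ} {a : Fin n} where
    open Pieces (proj₁ (lay i z≤n))

    InBall : Fin n → Set
    InBall z = π z ≡ i × Walk (above G π i) d a z

    levels : List ℕ
    levels = map ((level a ∸ d) +_) (upTo (suc (2 * d)))

    level-∈ : ∀ {z} → InBall z → level z List.∈ levels
    level-∈ {z} (_ , q) = subst (List._∈ levels) (ℕ.m+[n∸m]≡n lo≤) (List.∈-map⁺ _ (List.∈-upTo⁺ (s≤s hi)))
      where
      open ℕ.≤-Reasoning
      lo = level a ∸ d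
      lo≤ : lo ≤ level z
      lo≤ = ℕ.m≤n+o⇒m∸n≤o (level a) d
        (ℕ.≤-trans (walk-lipschitz level lipschitz (walk-sym q)) (ℕ.≤-reflexive (ℕ.+-comm _ d)))
      hi : level z ∸ lo ≤ 2 * d
      hi = ℕ.m≤n+o⇒m∸n≤o (level z) lo (begin
        level z                ≤⟨ walk-lipschitz level lipschitz q ⟩
        level a + d            ≤⟨ ℕ.+-monoˡ-≤ d (ℕ.m≤n+m∸n (level a) d) ⟩
        d + lo + d             ≡⟨ cong (_+ d) (ℕ.+-comm d lo) ⟩
        lo + d + d             ≡⟨ ℕ.+-assoc lo d d ⟩
        lo + (d + d)           ≡⟨ cong (λ e → lo + (d + e)) (ℕ.+-identityʳ d) ⟨
        lo + 2 * d             ∎)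

    level-fibre : ∀ {m k zs} → Unique zs → All (λ z → InBall z × piece z ≡ m) zs → All (λ z → level z ≡ k) zs →
                  length zs ≤ 1
    level-fibre {zs = []}        _ _ _ = z≤n
    level-fibre {zs = _ ∷ []}    _ _ _ = ℕ.≤-refl
    level-fibre {zs = _ ∷ _ ∷ _} ((≢ ∷ _) ∷ _) (((e , _) , f) ∷ ((e′ , _) , f′) ∷ _) (g ∷ g′ ∷ _) =
      contradiction (injective e e′ (trans f (sym f′)) (trans g (sym g′))) ≢

    -- In a ball of radius `d` the level takes at most `2 d + 1` values, and each piece has at most
    -- one vertex of each level in part `i`.
    ball-part : ∀ {zs} → Unique zs → All InBall zs → length zs ≤ p * suc (2 * d)
    ball-part {zs} zs! ins = begin
      length zs                        ≤⟨ fibre-bound _≟_ piece (suc (2 * d)) piece-fibre (allFin p) zs! ins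
                                            (All.universal (λ z → List.∈-allFin (piece z)) zs) ⟩
      length (allFin p) * suc (2 * d)  ≡⟨ cong (_* suc (2 * d)) (List.length-tabulate {n = p} (λ i → i)) ⟩
      p * suc (2 * d)                  ∎
      where
      open ℕ.≤-Reasoning
      piece-fibre : ∀ {ys m} → Unique ys → All InBall ys → All (λ z → piece z ≡ m) ys → length ys ≤ suc (2 * d)
      piece-fibre {ys} ys! ins eqs = begin
        length ys                      ≤⟨ fibre-bound ℕ._≟_ level 1 level-fibre levels ys! (All.zip (ins , eqs))
                                            (All.map level-∈ ins) ⟩
        length levels * 1              ≡⟨ ℕ.*-identityʳ _ ⟩
        length levels                  ≡⟨ List.length-map _ (upTo (suc (2 * d))) ⟩
        length (upTo (suc (2 * d)))    ≡⟨ List.length-upTo (suc (2 * d)) ⟩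
        suc (2 * d)                    ∎

  parts-fibre : ∀ {d a j zs} → Unique zs → All (λ z → Walk (above G π (π z)) d a z) zs → All (λ z → π z ≡ j) zs →
                length zs ≤ p * suc (2 * d)
  parts-fibre {d} {a} {j} zs! ws eqs =
    ball-part {j} {d} {a} zs! (All.zipWith (λ { (w , refl) → refl , w }) (ws , eqs))

  -- Weak reachability, as for weak colouring numbers, with the vertices ordered by their parts.
  Below : ℕ → Fin n → Fin n → Set
  Below d v y = Walk (above G π (π y)) d v y

  below? : ∀ d v y → Dec (Below d v y)
  below? d v y = walk? (above G π (π y)) d v y

  reached : Fin n → List (Fin n)
  reached a = filter (below? r a) (allFin n)

  -- At most `(r + 1) ^ (h - 2)` parts are reached, with at most `(h - 3) (2 r + 1)` vertices in
  -- each.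
  W : ℕ
  W = suc r ^ suc p * (p * suc (2 * r))

  reached-bound : ∀ a → length (reached a) ≤ W
  reached-bound a = begin
    length (reached a)               ≤⟨ fibre-bound ℕ._≟_ π (p * suc (2 * r)) parts-fibre parts
                                          (Unique.filter⁺ (below? r a) (Unique.allFin⁺ n)) walks
                                          (All.map (λ {y} w → let re = y , refl , w in
                                            List.∈-filter⁺ (reaches? G π a r) (List.∈-upTo⁺ (s≤s (reaches⇒≤ G π re))) re) walks) ⟩
    length parts * (p * suc (2 * r)) ≤⟨ ℕ.*-monoˡ-≤ _ (reached-parts G π nb-bound a r
                                          (Unique.filter⁺ (reaches? G π a r) (Unique.upTo⁺ _))
                                          (All.all-filter (reaches? G π a r) (upTo (suc (π a))))) ⟩
    W                                ∎
    where
    open ℕ.≤-Reasoning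
    parts : List ℕ
    parts = filter (reaches? G π a r) (upTo (suc (π a)))
    walks : All (Below r a) (reached a)
    walks = All.all-filter (below? r a) (allFin n)

  -- If y is the key of v (see below), then a path of length at most r from v to A that leaves
  -- {π ≥ π y} does so at a gate, and otherwise its lowest vertex is a gate.
  Gate : Fin n → Fin n → Set
  Gate y z = (π z ≡ π y ⊎ Nb G π (π y) y (π z)) × Below (2 * r) y z

  gate? : ∀ y z → Dec (Gate y z)
  gate? y z = (π z ℕ.≟ π y ⊎-dec nb? G π (π y) y (π z)) ×-dec below? (2 * r) y z

  gates : Fin n → List (Fin n)
  gates y = filter (gate? y) (allFin n)

  -- The part of `y` and at most `suc p` parts next to its component, each with at most
  -- `p (4 r + 1)` vertices reached within `2 r` steps.
  X : ℕ
  X = (2 + p) * (p * suc (2 * (2 * r)))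

  gates-bound : ∀ y → length (gates y) ≤ X
  gates-bound y = begin
    length (gates y)                                ≤⟨ fibre-bound ℕ._≟_ π (p * suc (2 * (2 * r)))
                                                         parts-fibre (π y ∷ nbs)
                                                         (Unique.filter⁺ (gate? y) (Unique.allFin⁺ n))
                                                         (All.map proj₂ all-gates) (All.map π-∈ all-gates) ⟩
    suc (length nbs) * (p * suc (2 * (2 * r)))      ≤⟨ ℕ.*-monoˡ-≤ _ (s≤s (nb-bound (π y)
                                                         (Unique.filter⁺ (nb? G π (π y) y) (Unique.upTo⁺ (π y)))
                                                         (All.all-filter (nb? G π (π y) y) (upTo (π y))))) ⟩
    X                                               ∎
    where
    open ℕ.≤-Reasoning
    nbs : List ℕ
    nbs = filter (nb? G π (π y) y) (upTo (π y))
    all-gates : All (Gate y) (gates y)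
    all-gates = All.all-filter (gate? y) (allFin n)
    π-∈ : ∀ {z} → Gate y z → π z List.∈ π y ∷ nbs
    π-∈ (inj₁ eq , _) = here eq
    π-∈ (inj₂ nb , _) = there (List.∈-filter⁺ (nb? G π (π y) y) (List.∈-upTo⁺ (proj₁ (proj₂ nb))) nb)

  -- The pair `(z , l)` stands for the ball of radius `l` around the gate `z`. Membership in these
  -- balls turns the distances to the gates into a set system.
  points : Fin n → List (Fin n × ℕ)
  points y = cartesianProduct (gates y) (upTo (suc r))

  points-bound : ∀ y → length (points y) ≤ X * suc r
  points-bound y = begin
    length (points y)                          ≡⟨ length-cartesianProduct (gates y) (upTo (suc r)) ⟩
    length (gates y) * length (upTo (suc r))   ≡⟨ cong (length (gates y) *_) (List.length-upTo (suc r)) ⟩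
    length (gates y) * suc r                   ≤⟨ ℕ.*-monoˡ-≤ (suc r) (gates-bound y) ⟩
    X * suc r                                  ∎
    where open ℕ.≤-Reasoning

  module _ (A : Subset n) where

    Candidate : Fin n → Fin n → Set
    Candidate v y = Below r v y × ∃ λ a → a ∈ A × Below r a y

    candidate? : ∀ v y → Dec (Candidate v y)
    candidate? v y = below? r v y ×-dec any? λ a → a ∈? A ×-dec below? r a y

    Key : Fin n → Fin n → Set
    Key v y = Candidate v y × ∀ {z} → Candidate v z → π z ≤ π y

    -- The lowest vertex of the walk is a candidate, and among the candidates one with maximal `π`
    -- is taken.
    key-exists : ∀ {v a} → a ∈ A → Walk G r a v → ∃ λ y → Key v y
    key-exists {v} {a} a∈A q with z , d₁ , d₂ , le , _ , q₁ , q₂ ← lowest {G = G} {G} π (λ e → e) q =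
      Extrema.argmax π z cands , is-candidate ,
      λ {y} c → All.lookup (Extrema.f[xs]≤f[argmax] z cands) (List.∈-filter⁺ (candidate? v) (List.∈-allFin y) c)
      where
      cands : List (Fin n)
      cands = filter (candidate? v) (allFin n)
      is-candidate : Candidate v (Extrema.argmax π z cands)
      is-candidate with Extrema.argmax-sel π z cands
      ... | inj₁ eq rewrite eq = walk-≤ (ℕ.m+n≤o⇒n≤o d₁ le) q₂ , a , a∈A , walk-≤ (ℕ.m+n≤o⇒m≤o d₁ le) q₁
      ... | inj₂ y∈ = proj₂ (List.∈-filter⁻ (candidate? v) {xs = allFin n} y∈)

    -- If the walk stays in {π ≥ π y}, its lowest vertex is a candidate and hence, by maximality, in
    -- the part of `y`. Otherwise, seen from `v`, the first vertex outside lies in a part next to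
    -- the component of `y`. As `y` is within `r` of `v`, either vertex is within `2 r` of `y`, so
    -- it is a gate, and only the stretch between it and `v` is replaced.
    through-gate : ∀ {v v′ y} → Key v y → (∀ {z l} → Gate y z → l ≤ r → Walk G l z v → Walk G l z v′) →
                   ∀ {a l} → a ∈ A → l ≤ r → Walk G l a v → Walk G l a v′
    through-gate {v} {v′} {y} ((v→y , _) , maximal) gate {a} {l} a∈A l≤r a→v
      with exit G π {H = G} {i = π y} (λ e → e) (walk-above G ℕ.≤-refl (walk-sym v→y)) (walk-sym a→v)
    ... | inj₁ v→a with z , d₁ , d₂ , le , v→z₀ , v→z , a→z ← lowest {G = G} {above G π (π y)} π (above-⊑ G {π} {π y}) v→a =
      walk-≤ (ℕ.≤-trans (ℕ.≤-reflexive (ℕ.+-comm d₂ d₁)) le)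
        (walk-trans (down a→z) (gate {z} (inj₁ z≡y , y→z) d₁≤r (walk-sym (down v→z))))
      where
      down : ∀ {d u w} → Walk (above G π (π z)) d u w → Walk G d u w
      down = walk-⊑ (above-⊑ G {π} {π z})
      d₁≤r : d₁ ≤ r
      d₁≤r = ℕ.≤-trans (ℕ.m+n≤o⇒m≤o d₁ le) l≤r
      d₂≤r : d₂ ≤ r
      d₂≤r = ℕ.≤-trans (ℕ.m+n≤o⇒n≤o d₁ le) l≤r
      z≡y : π z ≡ π y
      z≡y = ℕ.≤-antisym (maximal (walk-≤ d₁≤r v→z , a , a∈A , walk-≤ d₂≤r a→z))
                        (walk-above G (walk-above G ℕ.≤-refl (walk-sym v→y)) v→z₀)
      y→z : Below (2 * r) y z
      y→z = walk-trans (subst (λ i → Walk (above G π i) r y v) (sym z≡y) (walk-sym v→y))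
                       (walk-≤ (ℕ.≤-trans d₁≤r (ℕ.≤-reflexive (sym (ℕ.+-identityʳ r)))) v→z)
    ... | inj₂ (exit-at {len₁} {len₂} {c} {w} v→c e w<y w→a le) =
      walk-≤ (ℕ.≤-trans (ℕ.≤-reflexive (ℕ.+-comm len₂ (suc len₁))) le)
        (walk-trans (walk-sym w→a) (gate (inj₂ nb , y→w) len≤r (walk-sym (walk-snoc (walk-⊑ (above-⊑ G {π} {π y}) v→c) e))))
      where
      len≤r : suc len₁ ≤ r
      len≤r = ℕ.≤-trans (ℕ.m+n≤o⇒m≤o (suc len₁) le) l≤r
      y→c : Walk (above G π (π y)) (r + len₁) y c
      y→c = walk-trans (walk-sym v→y) v→c
      nb : Nb G π (π y) y (π w)
      nb = ℕ.≤-refl , w<y , c , w , walk-shorten (above G π (π y)) y→c , e , refl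
      w≤c : π w ≤ π c
      w≤c = ℕ.≤-trans (ℕ.<⇒≤ w<y) (walk-above G ℕ.≤-refl y→c)
      y→w : Below (2 * r) y w
      y→w = walk-≤ (ℕ.≤-trans (ℕ.≤-reflexive (sym (ℕ.+-suc r len₁)))
                     (ℕ.+-monoʳ-≤ r (ℕ.≤-trans len≤r (ℕ.≤-reflexive (sym (ℕ.+-identityʳ r))))))
              (walk-snoc (walk-⊑ (above-mono G (ℕ.<⇒≤ w<y)) y→c) (w≤c , ℕ.≤-refl , e))

    -- Bundling a vertex with a key makes the key a function on the elements that are counted.
    Keyed : Set
    Keyed = ∃₂ λ v y → Key v y

    vertex key : Keyed → Fin n
    vertex (v , _)  = v
    key (_ , y , _) = y

    within : Keyed → Fin n × ℕ → Bool
    within e (z , l) = does (walk? G l z (vertex e))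

    open Sauer within

    -- Both vertices have the key `y`, so `through-gate` applies in both directions.
    trace⇒profile : ∀ {y} e e′ → key e ≡ y → key e′ ≡ y → trace (points y) e ≡ trace (points y) e′ →
                    profile G r (vertex e) A ≈ₚ profile G r (vertex e′) A
    trace⇒profile e@(v , y , k) e′@(v′ , _ , k′) refl refl tr a a∈A = equal (capped G r a v) (capped G r a v′)
      where
      transfer : ∀ e e′ → trace (points y) e ≡ trace (points y) e′ →
                 ∀ {z l} → Gate y z → l ≤ r → Walk G l z (vertex e) → Walk G l z (vertex e′)
      transfer e e′ tr {z} {l} g l≤r = does-⇒ (walk? G l z (vertex e)) (walk? G l z (vertex e′))
        (trace-∈ {points y} {e} {e′} {z , l} tr (List.∈-cartesianProduct⁺ (List.∈-filter⁺ (gate? y) (List.∈-allFin z) g) (List.∈-upTo⁺ (s≤s l≤r))))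
      to : ∀ {l} → l ≤ r → Walk G l a v → Walk G l a v′
      to = through-gate k (λ {z} → transfer e e′ tr {z}) a∈A
      from : ∀ {l} → l ≤ r → Walk G l a v′ → Walk G l a v
      from = through-gate k′ (λ {z} → transfer e′ e (sym tr) {z}) a∈A
      equal : ∀ {c c′} → Capped G r a v c → Capped G r a v′ c′ → c ≡ c′
      equal (beyond _)  (beyond _)         = refl
      equal (beyond ¬q) (attained ℓ≤r q _)  = contradiction (walk-≤ ℓ≤r (from ℓ≤r q)) ¬q
      equal (attained ℓ≤r q _) (beyond ¬q)  = contradiction (walk-≤ ℓ≤r (to ℓ≤r q)) ¬q
      equal (attained ℓ≤r q min) (attained ℓ′≤r q′ min′) =
        cong just (ℕ.≤-antisym (min (from ℓ′≤r q′)) (min′ (to ℓ≤r q)))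

    -- The `h` shattered balls give the centres and radii of a Voronoi diagram, and the shattering
    -- vertices give `select`.
    ¬shatters : ∀ {y es} (Q : Vec (Fin n × ℕ) (4 + p′)) → VecAll.All (List._∈ points y) Q → ¬ Shatters es Q
    ¬shatters {y} {es} Q Q⊆ sh = ¬minor (Voronoi.minor G r (λ i → proj₁ (lookup Q i)) (λ i → proj₂ (lookup Q i)) l≤r select)
      where
      l≤r : ∀ i → proj₂ (lookup Q i) ≤ r
      l≤r i = s≤s⁻¹ (List.∈-upTo⁻ (proj₂ (List.∈-cartesianProduct⁻ (gates y) (upTo (suc r)) (VecAll.lookup⁺ Q⊆ i))))
      select : ∀ b → ∃ λ v → ∀ i → does (walk? G (proj₂ (lookup Q i)) (proj₁ (lookup Q i)) v) ≡ b i
      select b with e , _ , eq ← sh (tabulate b) = vertex e , λ i →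
        trans (sym (Vec.lookup-map i (within e) Q)) (trans (cong (λ bs → lookup bs i) eq) (Vec.lookup∘tabulate b i))

    Distinct : Keyed → Keyed → Set
    Distinct e e′ = ¬ profile G r (vertex e) A ≈ₚ profile G r (vertex e′) A

    M : ℕ
    M = suc (X * suc r) ^ (2 + p)

    key-fibre : ∀ {y es} → AllPairs Distinct es → All (λ e → key e List.∈ concatMap reached (elements A)) es →
                All (λ e → key e ≡ y) es → length es ≤ M
    key-fibre {y} {es} dist _ eqs = begin
      length es                                  ≤⟨ sauer-shelah (3 + p) (points y)
                                                      (AllPairs.map (λ {e} {e′} (eq , eq′ , ne) tr → ne (trace⇒profile e e′ eq eq′ tr)) (all-pairs eqs dist))
                                                      ¬shatters ⟩
      Φ (3 + p) (length (points y))              ≤⟨ Φ-≤ (2 + p) _ ⟩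
      suc (length (points y)) ^ (2 + p)          ≤⟨ ℕ.^-monoˡ-≤ (2 + p) (s≤s (points-bound y)) ⟩
      M                                          ∎
      where open ℕ.≤-Reasoning

    keyed-bound : ∀ {es} → AllPairs Distinct es → length es ≤ ∣ A ∣ * W * M
    keyed-bound {es} dist = begin
      length es                                      ≤⟨ fibre-bound _≟_ {S = λ e → key e List.∈ keys} key M key-fibre keys dist key∈ key∈ ⟩
      length keys * M                                ≤⟨ ℕ.*-monoˡ-≤ M (length-concatMap reached W reached-bound (elements A)) ⟩
      length (elements A) * W * M                    ≡⟨ cong (λ k → k * W * M) (length-elements A) ⟩
      ∣ A ∣ * W * M                                  ∎
      where
      open ℕ.≤-Reasoning
      keys : List (Fin n)
      keys = concatMap reached (elements A)
      key∈ : All (λ e → key e List.∈ keys) es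
      key∈ = All.universal (λ { (_ , y , (_ , a , a∈A , q) , _) →
        List.∈-concatMap⁺ reached (Any.map (λ { refl → List.∈-filter⁺ (below? r a) (List.∈-allFin y) q }) (∈-elements a∈A)) }) es

    -- A profile that is not constantly infinite belongs to a vertex within distance `r` of `A`,
    -- which has a key. Deduplication makes these profiles pairwise different.
    pcOf-bound : pcOf G r A ≤ ∣ A ∣ * W * M
    pcOf-bound = let es , eq = all⇒map (λ e → profile G r (vertex e) A) (All.tabulate keyed) in begin
      pcOf G r A       ≡⟨ cong length eq ⟨
      length (map (λ e → profile G r (vertex e) A) es) ≡⟨ List.length-map _ es ⟩
      length es        ≤⟨ keyed-bound (AllPairs.map⁻ (subst (AllPairs (λ p q → ¬ p ≈ₚ q)) (sym eq)
                            (AllPairs.filter⁺ nonconst? (deduplicate-! profile-decSetoid profiles)))) ⟩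
      ∣ A ∣ * W * M    ∎
      where
      open ℕ.≤-Reasoning
      profile-decSetoid : DecSetoid _ _
      profile-decSetoid = record
        { Carrier = Profile A ; _≈_ = _≈ₚ_
        ; isDecEquivalence = record
          { isEquivalence = record
            { refl  = λ _ _ → refl
            ; sym   = λ p≈q a a∈A → sym (p≈q a a∈A)
            ; trans = λ p≈q q≈s a a∈A → trans (p≈q a a∈A) (q≈s a a∈A)
            }
          ; _≟_ = _≈ₚ?_
          }
        }
      profiles : List (Profile A)
      profiles = map (λ v → profile G r v A) (allFin n)
      nonconst? : ∀ q → Dec (¬ q ≈ₚ const∞)
      nonconst? q = ¬? (q ≈ₚ? const∞)
      keyed : ∀ {q} → q List.∈ filter nonconst? (List.deduplicate _≈ₚ?_ profiles) →
              ∃ λ e → profile G r (vertex e) A ≡ q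
      keyed q∈ with q∈′ , nc ← List.∈-filter⁻ nonconst? {xs = List.deduplicate _≈ₚ?_ profiles} q∈
        with v , _ , refl ← List.∈-map⁻ (λ v → profile G r v A) (List.∈-deduplicate⁻ _≈ₚ?_ profiles q∈′)
        with any? (λ a → a ∈? A ×-dec walk? G r a v)
      ... | yes (_ , a∈A , q) = let y , k = key-exists a∈A q in (v , y , k) , refl
      ... | no  unreached = contradiction (λ a a∈A → infinite a∈A (capped G r a v)) nc
        where
        infinite : ∀ {a c} → a ∈ A → Capped G r a v c → c ≡ nothing
        infinite a∈A (beyond _)        = refl
        infinite a∈A (attained ℓ≤r q _) = contradiction (_ , a∈A , walk-≤ ℓ≤r q) unreached

-- The bounds

private
  open +-*-Solver
  open ℕ.≤-Reasoning

  bound : ℕ → ℕ → ℕ → ℕ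
  bound h r k = 4 ^ h * (h ∸ 3) * h ^ (2 * (h ∸ 1)) * (r + 1) ^ (3 * (h ∸ 1)) * k

  ^-distrib-* : ∀ a b k → (a * b) ^ k ≡ a ^ k * b ^ k
  ^-distrib-* a b zero    = refl
  ^-distrib-* a b (suc k) = trans (cong (a * b *_) (^-distrib-* a b k))
    (solve 4 (λ a b x y → a :* b :* (x :* y) := a :* x :* (b :* y)) refl a b (a ^ k) (b ^ k))

  base : ∀ p r → suc ((2 + p) * (p * suc (2 * (2 * r))) * suc r) ≤ 4 * ((3 + p) ^ 2 * suc r ^ 2)
  base p r = begin
    suc (x * s)                                     ≡⟨ ℕ.+-comm 1 (x * s) ⟩
    -- The `1` is enlarged to the exact difference between the right-hand side and `x * s`, computed
    -- from `4 r + 1 = 4 s - 3`.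
    x * s + 1                                       ≤⟨ ℕ.+-monoʳ-≤ (x * s) (ℕ.*-mono-≤ {1} {s} (s≤s z≤n) (s≤s z≤n)) ⟩
    x * s + s * (4 * (9 + 4 * p) * s + 3 * (p * (2 + p))) ≡⟨ solve 2 (λ p r →
      (con 2 :+ p) :* (p :* (con 1 :+ con 2 :* (con 2 :* r))) :* (con 1 :+ r) :+
      (con 1 :+ r) :* (con 4 :* (con 9 :+ con 4 :* p) :* (con 1 :+ r) :+ con 3 :* (p :* (con 2 :+ p))) :=
      con 4 :* ((con 3 :+ p) :^ 2 :* (con 1 :+ r) :^ 2)) refl p r ⟩
    4 * ((3 + p) ^ 2 * s ^ 2)                       ∎
    where
    s = suc r
    x = (2 + p) * (p * suc (2 * (2 * r)))

  -- Here `3 + p` is `h`. The powers of `r + 1` are `h - 2` from the parts, one from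
  -- `2 r + 1 ≤ 2 (r + 1)` and `2 (h - 1)` from the traces. The constants multiply to
  -- `2 * 4 ^ (h - 1)`, at most `4 ^ h`.
  total : ∀ p r k → k * (suc r ^ suc p * (p * suc (2 * r))) * suc ((2 + p) * (p * suc (2 * (2 * r))) * suc r) ^ (2 + p)
                    ≤ bound (3 + p) r k
  total p r k = begin
    k * (s ^ suc p * (p * suc (2 * r))) * suc ((2 + p) * (p * suc (2 * (2 * r))) * s) ^ q
      ≤⟨ ℕ.*-mono-≤ (ℕ.*-monoʳ-≤ k (ℕ.*-monoʳ-≤ (s ^ suc p) (ℕ.*-monoʳ-≤ p 1+2r≤2s))) (ℕ.^-monoˡ-≤ q (base p r)) ⟩
    k * (s ^ suc p * (p * (2 * s))) * (4 * (h ^ 2 * s ^ 2)) ^ q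
      ≡⟨ cong (k * (s ^ suc p * (p * (2 * s))) *_) powers ⟩
    k * (s ^ suc p * (p * (2 * s))) * (4 ^ q * (h ^ (2 * q) * s ^ (2 * q)))
      ≡⟨ solve 7 (λ k a p s b c d → k :* (a :* (p :* (con 2 :* s))) :* (b :* (c :* d)) :=
                                    con 2 :* (b :* p :* c :* ((s :* a) :* d) :* k))
               refl k (s ^ suc p) p s (4 ^ q) (h ^ (2 * q)) (s ^ (2 * q)) ⟩
    2 * (4 ^ q * p * h ^ (2 * q) * (s ^ q * s ^ (2 * q)) * k)
      ≤⟨ ℕ.*-monoˡ-≤ (4 ^ q * p * h ^ (2 * q) * (s ^ q * s ^ (2 * q)) * k) (ℕ.m≤m+n 2 2) ⟩
    4 * (4 ^ q * p * h ^ (2 * q) * (s ^ q * s ^ (2 * q)) * k)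
      ≡⟨ solve 6 (λ f a p b c k → f :* (a :* p :* b :* c :* k) := f :* a :* p :* b :* c :* k)
               refl 4 (4 ^ q) p (h ^ (2 * q)) (s ^ q * s ^ (2 * q)) k ⟩
    4 * 4 ^ q * p * h ^ (2 * q) * (s ^ q * s ^ (2 * q)) * k
      ≡⟨ cong (λ x → 4 * 4 ^ q * p * h ^ (2 * q) * x * k)
              (trans (sym (ℕ.^-distribˡ-+-* s q (2 * q))) (cong (_^ (3 * q)) (ℕ.+-comm 1 r))) ⟩
    bound h r k ∎
    where
    s = suc r
    q = 2 + p
    h = 3 + p
    1+2r≤2s : suc (2 * r) ≤ 2 * s
    1+2r≤2s = s≤s (ℕ.+-monoʳ-≤ r (ℕ.n≤1+n (r + 0)))
    powers : (4 * (h ^ 2 * s ^ 2)) ^ q ≡ 4 ^ q * (h ^ (2 * q) * s ^ (2 * q))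
    powers = trans (^-distrib-* 4 (h ^ 2 * s ^ 2) q) (cong (4 ^ q *_)
      (trans (^-distrib-* (h ^ 2) (s ^ 2) q) (cong₂ _*_ (ℕ.^-*-assoc h 2 q) (ℕ.^-*-assoc s 2 q))))

  -- Both `4` and `h - 3` are at most `h`, which gives the exponent `3 h - 1`, rounded up to `4 h`.
  bound≤ : ∀ p r k → bound (4 + p) r k ≤ (4 + p) ^ (4 * (4 + p)) * (r + 1) ^ (3 * (3 + p)) * k
  bound≤ p r k = ℕ.*-monoˡ-≤ k (ℕ.*-monoˡ-≤ ((r + 1) ^ (3 * (3 + p))) (begin
    4 ^ h * suc p * h ^ (2 * q)   ≤⟨ ℕ.*-monoˡ-≤ (h ^ (2 * q)) (ℕ.*-mono-≤ (ℕ.^-monoˡ-≤ h (ℕ.m≤m+n 4 p)) (s≤s (ℕ.m≤n+m p 3))) ⟩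
    h ^ h * h * h ^ (2 * q)       ≡⟨ ℕ.*-assoc (h ^ h) h _ ⟩
    h ^ h * h ^ (1 + 2 * q)       ≡⟨ ℕ.^-distribˡ-+-* h h (1 + 2 * q) ⟨
    h ^ (h + (1 + 2 * q))         ≤⟨ ℕ.^-monoʳ-≤ h (ℕ.≤-trans (ℕ.m≤m+n (h + (1 + 2 * q)) (5 + p)) (ℕ.≤-reflexive (solve 1 (λ p →
      con 4 :+ p :+ (con 1 :+ con 2 :* (con 3 :+ p)) :+ (con 5 :+ p) := con 4 :* (con 4 :+ p)) refl p))) ⟩
    h ^ (4 * h)                   ∎))
    where
    h = 4 + p
    q = 3 + p

pc-bound : ∀ r h → h ≥ 4 → ∀ {n} (G : Graph n) → ¬ (Complete h MinorOf G) → ∀ k → pc G r k ≤ bound h r k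
pc-bound r (suc (suc (suc (suc p)))) (s≤s (s≤s (s≤s (s≤s z≤n)))) {n} G ¬minor k =
  let π , lay = Layering.layering G p ¬minor in
  Extrema.max≤v⁺ {bound (4 + p) r k} z≤n (All.map⁺ (All.map
    (λ { {A} refl → ℕ.≤-trans (Profiles.pcOf-bound G p ¬minor r π lay A) (total (suc p) r ∣ A ∣) })
    (All.all-filter (λ A → ∣ A ∣ ℕ.≟ k) (subsets n))))

theorem20 :
  (∀ (r h : ℕ) → h ≥ 4 →
   ∀ {n} (G : Graph n) → ¬ (Complete h MinorOf G) →
   ∀ k → 1 ≤ k → k ≤ n →
   pc G r k ≤ 4 ^ h * (h ∸ 3) * h ^ (2 * (h ∸ 1)) * (r + 1) ^ (3 * (h ∸ 1)) * k)
  ×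
  (∃[ c ] (∀ (r h : ℕ) → h ≥ 4 →
           ∀ {n} (G : Graph n) → ¬ (Complete h MinorOf G) →
           ∀ k → 1 ≤ k → k ≤ n →
           pc G r k ≤ h ^ (c * h) * (r + 1) ^ (3 * (h ∸ 1)) * k))
theorem20 =
  (λ r h h≥4 G ¬minor k _ _ → pc-bound r h h≥4 G ¬minor k) ,
  4 , λ { r (suc (suc (suc (suc p)))) h≥4 G ¬minor k _ _ →
          ℕ.≤-trans (pc-bound r (4 + p) h≥4 G ¬minor k) (bound≤ p r k)
        ; r 0 () ; r 1 (s≤s ()) ; r 2 (s≤s (s≤s ())) ; r 3 (s≤s (s≤s (s≤s ()))) }
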